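{- Let $p,q,r$ be pairwise distinct primes with $p<q$ and $p<r$. Then for every integer $n$, $$|a_{pqr}(n)-a_{pqr}(n-1)|\le 1.$$
   Context: $\Phi_{pqr}(x)=\prod_{0<k<pqr,\ \gcd(k,pqr)=1}(x-\zeta^k)$, where $\zeta$ is a primitive $pqr$-th root of unity, is the ternary cyclotomic polynomial; $a_{pqr}(n)$ denotes its coefficient of $x^n$ (zero for $n$ outside $[0,\deg\Phi_{pqr}]$). -}

module Defs where

open import Algebra.Apartness.Bundles using (HeytingCommutativeRing; HeytingField)
open import Algebra.Bundles using (CommutativeRing; Semiring)
open import Algebra.Bundles.Raw using (RawRing)
import Algebra.Definitions.RawSemiring as RawSemiringDefs
open import Data.Integer.Base using (ℤ; +_; -[1+_])
open import Data.List.Base using (List; []; _∷_; map; filter; foldr; upTo)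
open import Data.Nat.Base using (ℕ; zero; suc; _<_)
open import Data.Nat.GCD using (gcd)
open import Data.Nat.Properties using (_≟_; _<?_)
open import Data.Product.Base using (_×_)
open import Relation.Nullary.Decidable using (_×-dec_)
open import Relation.Nullary.Negation using (¬_)

-- A polynomial is its list of coefficients, constant term first; trailing
-- zeros are allowed.
module Polynomial {c ℓ} (R : RawRing c ℓ) where
  open RawRing R

  Poly : Set c
  Poly = List Carrier

  infixl 6 _+ₚ_
  infixl 7 _*ₚ_

  _+ₚ_ : Poly → Poly → Poly
  []      +ₚ g       = g
  (a ∷ f) +ₚ []      = a ∷ f
  (a ∷ f) +ₚ (b ∷ g) = (a + b) ∷ (f +ₚ g)

  _*ₚ_ : Poly → Poly → Poly
  []      *ₚ g = []
  (a ∷ f) *ₚ g = map (a *_) g +ₚ (0# ∷ (f *ₚ g))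

  X-_ : Carrier → Poly
  X- a = (- a) ∷ 1# ∷ []

  ∏ₚ : List Poly → Poly
  ∏ₚ = foldr _*ₚ_ (1# ∷ [])

  coeffℕ : Poly → ℕ → Carrier
  coeffℕ []      _       = 0#
  coeffℕ (a ∷ f) zero    = a
  coeffℕ (a ∷ f) (suc n) = coeffℕ f n

  coeff : Poly → ℤ → Carrier
  coeff f (+ n)    = coeffℕ f n
  coeff f -[1+ n ] = 0#

-- { k | 0 < k < N , gcd(k,N) = 1 }, each element listed once.
totatives : ℕ → List ℕ
totatives N = filter (λ k → (0 <? k) ×-dec (gcd k N ≟ 1)) (upTo N)

module Cyclotomic {c ℓ₁ ℓ₂} (K : HeytingField c ℓ₁ ℓ₂) where

  commutativeRing : CommutativeRing c ℓ₁
  commutativeRing =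
    HeytingCommutativeRing.commutativeRing (HeytingField.heytingCommutativeRing K)

  open CommutativeRing commutativeRing public using (Carrier; _≈_)
  open CommutativeRing commutativeRing using (-_; 0#; 1#; rawRing; semiring)
  open RawSemiringDefs (Semiring.rawSemiring semiring) using (_^_) renaming (_×_ to _·_)
  open Polynomial rawRing public

  fromℤ : ℤ → Carrier
  fromℤ (+ n)    = n · 1#
  fromℤ -[1+ n ] = - (suc n · 1#)

  CharacteristicZero : Set ℓ₁
  CharacteristicZero = ∀ n → ¬ (suc n · 1# ≈ 0#)

  IsPrimitiveRoot : ℕ → Carrier → Set ℓ₁
  IsPrimitiveRoot N ζ = (ζ ^ N ≈ 1#) × (∀ k → 0 < k → k < N → ¬ (ζ ^ k ≈ 1#))

  -- The N-th cyclotomic polynomial when ζ is a primitive N-th root of unity.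
  Φ : ℕ → Carrier → Poly
  Φ N ζ = ∏ₚ (map (λ k → X- (ζ ^ k)) (totatives N))

{-# OPTIONS --safe #-}
module Submission where

-- Multiplication of a power series by xᵐ - 1 is the difference operator T m. Write every integer
-- uniquely as n = α pq + β pr + γ qr + κ pqr with 0 ≤ α < r, 0 ≤ β < q, 0 ≤ γ < p, and let
-- M n = max (0, κ + 1). Subtracting pq, pr or qr just lowers one digit, which gives
-- T(pq) T(pr) T(qr) M = T(pqr) δ; comparing with
--   Φ(x) (x - 1) (x^pq - 1) (x^pr - 1) (x^qr - 1) = (x^pqr - 1) (x^p - 1) (x^q - 1) (x^r - 1)
-- shows that the jumps of the coefficients of Φ are, up to sign, T(p) T(q) T(r) M.
--
-- If p has digits (μ, ν, 0, -1), then M (n - p) - M n is -[κ ≥ 0] when α < μ and β < ν,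
-- [κ ≥ -1] when α ≥ μ and β ≥ ν, and 0 otherwise. A jump is the mixed difference of this
-- quantity over the corners n, n - q, n - r, n - q - r. Shifting by q keeps β and shifting by r
-- keeps α, so two contributions can reinforce each other only if all four corners are of the same
-- kind, with both ends of one diagonal above the threshold and both ends of the other below it.
-- This is impossible, because γ + pκ has the same sum over both diagonals.

open import Defs
open import Algebra.Apartness.Bundles using (HeytingField)
open import Algebra.Bundles using (CommutativeRing; Semiring)
import Algebra.Definitions.RawSemiring as RawSemiringDefs
import Algebra.Solver.Ring.NaturalCoefficients.Default
open import Data.Bool.Base using (Bool; true; false; if_then_else_)
open import Data.Empty using (⊥; ⊥-elim)
open import Data.Integer.Base as ℤ using (ℤ; +_; -[1+_]; 0ℤ; 1ℤ; -1ℤ; ∣_∣)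
open import Data.Integer.DivMod using (_%ℕ_; _/ℕ_; n%ℕd<d; a≡a%ℕn+[a/ℕn]*n)
import Data.Integer.Properties as ℤ
open import Algebra.Properties.AbelianGroup ℤ.+-0-abelianGroup using () renaming (∙-cancelˡ to ℤ-+-cancelˡ)
open import Data.Integer.Tactic.RingSolver using (solve-∀)
open import Data.List.Base using (List; []; _∷_; map; filter; foldr; upTo; applyUpTo)
open import Data.List.Membership.Propositional using (_∈_)
open import Data.List.Membership.Propositional.Properties using (∈-filter⁺; ∈-filter⁻; ∈-map⁺; ∈-map⁻; ∈-upTo⁺; ∈-upTo⁻)
open import Data.List.Membership.Propositional.Properties.WithK using (unique∧set⇒bag)
open import Data.List.Relation.Binary.BagAndSetEquality using (∼bag⇒↭)
open import Data.List.Relation.Binary.Permutation.Propositional as ↭ using (_↭_; ↭-trans; ↭-sym)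
open import Data.List.Relation.Binary.Permutation.Propositional.Properties using (++-comm; ++⁺ˡ; ↭-reverse)
open import Data.List.Relation.Unary.All using (All; []; _∷_)
import Data.List.Relation.Unary.Unique.Propositional.Properties as Unique
open import Data.Nat.Base as ℕ using (ℕ; zero; suc; _≤_; _<_; z≤n; s≤s; _∸_; NonZero)
open import Data.Nat.Coprimality as Coprime using (Coprime; coprime-divisor; coprime-Bézout; coprime⇒gcd≡1)
open import Data.Nat.Divisibility
open import Data.Nat.GCD using (gcd; gcd-greatest; module Bézout)
open import Data.Nat.Induction using (<-rec)
open import Data.Nat.Primality using (Prime; prime⇒nonZero; prime⇒irreducible; prime⇒nonTrivial; ¬prime[1])
import Data.Nat.Properties as ℕ
open import Data.Product.Base using (Σ; ∃; ∃₂; _×_; _,_; proj₁; proj₂)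
open import Data.Sum.Base using (inj₁; inj₂)
open import Function.Base using (_∘_)
open import Function.Bundles using (mk⇔)
open import Relation.Binary.Definitions using (tri<; tri≈; tri>)
open import Relation.Binary.PropositionalEquality as ≡ using (_≡_; _≢_; cong; cong₂; subst; subst₂; module ≡-Reasoning)
import Relation.Binary.Reasoning.Setoid
open import Relation.Nullary using (Dec; yes; no; does; ofʸ; ofⁿ; ¬_; ¬?; _×-dec_; contradiction)
open import Relation.Nullary.Decidable using (True; toWitness)
open import Relation.Unary using (Decidable)

-- Formal power series as sequences on ℤ, and multiplication by binomials.

module Sequences {c ℓ} (R : CommutativeRing c ℓ) where
  open CommutativeRing R
  open import Algebra.Properties.Ring ring using (-1*x≈-x; -‿injective)
  open import Algebra.Properties.Group +-group using () renaming (∙-cancelˡ to +-cancelˡ)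
  open Relation.Binary.Reasoning.Setoid setoid
  open Algebra.Solver.Ring.NaturalCoefficients.Default commutativeSemiring
    using (solve; _:=_; _:+_; _:*_)

  Seq : Set c
  Seq = ℤ → Carrier

  infix 4 _≋_
  _≋_ : Seq → Seq → Set ℓ
  f ≋ g = ∀ n → f n ≈ g n

  -- Singles out the power series among all sequences on ℤ. Without this, `T m` could not be
  -- cancelled, since it kills every sequence of period m.
  Causal : Seq → Set ℓ
  Causal f = ∀ n → f -[1+ n ] ≈ 0#

  δ : Seq
  δ (+ zero)  = 1#
  δ (+ suc _) = 0#
  δ -[1+ _ ]  = 0#

  -- Multiplication by the binomial xᵐ + u.
  B : ℕ → Carrier → Seq → Seq
  B m u f n = f (n ℤ.- + m) + u * f n

  T : ℕ → Seq → Seq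
  T m = B m (- 1#)

  L : Carrier → Seq → Seq
  L a = B 1 (- a)

  δ-causal : Causal δ
  δ-causal _ = refl

  causal-shift : ∀ {f} → Causal f → ∀ m n → f (-[1+ n ] ℤ.- + m) ≈ 0#
  causal-shift h zero    n = h n
  causal-shift h (suc m) n = h _

  binomial-0 : ∀ u {x y} → x ≈ 0# → y ≈ 0# → x + u * y ≈ 0#
  binomial-0 u x≈0 y≈0 = trans (+-cong x≈0 (trans (*-congˡ y≈0) (zeroʳ u))) (+-identityˡ 0#)

  B-causal : ∀ m u f → Causal f → Causal (B m u f)
  B-causal m u f h n = binomial-0 u (causal-shift {f} h m n) (h n)

  B-cong : ∀ m {u v f g} → u ≈ v → f ≋ g → B m u f ≋ B m v g
  B-cong m u≈v e n = +-cong (e _) (*-cong u≈v (e n))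

  T-cong : ∀ m {f g} → f ≋ g → T m f ≋ T m g
  T-cong m = B-cong m refl

  B-comm : ∀ m u k v f → B m u (B k v f) ≋ B k v (B m u f)
  B-comm m u k v f n = begin
    (f (n ℤ.- + m ℤ.- + k) + v * f (n ℤ.- + m)) + u * (f (n ℤ.- + k) + v * f n)
      ≡⟨ cong (λ i → (f i + v * f (n ℤ.- + m)) + u * (f (n ℤ.- + k) + v * f n)) (shift-comm n (+ m) (+ k)) ⟩
    (f (n ℤ.- + k ℤ.- + m) + v * f (n ℤ.- + m)) + u * (f (n ℤ.- + k) + v * f n)
      ≈⟨ solve 6 (λ u v x y z w → ((x :+ v :* y) :+ u :* (z :+ v :* w)) := ((x :+ u :* z) :+ v :* (y :+ u :* w)))
           refl u v _ _ _ _ ⟩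
    (f (n ℤ.- + k ℤ.- + m) + u * f (n ℤ.- + k)) + v * (f (n ℤ.- + m) + u * f n) ∎
    where
    shift-comm : ∀ n i j → n ℤ.- i ℤ.- j ≡ n ℤ.- j ℤ.- i
    shift-comm = solve-∀

  T-comm : ∀ m k f → T m (T k f) ≋ T k (T m f)
  T-comm m k = B-comm m (- 1#) k (- 1#)

  -- Strong induction: `f n` is `f (n - m)` minus `T m f n`, and n - m is either negative, where
  -- causality applies, or a smaller natural number.
  T-injective : ∀ m {f g} → 0 < m → Causal f → Causal g → T m f ≋ T m g → f ≋ g
  T-injective m {f} {g} _ cf cg e -[1+ n ] = trans (cf n) (sym (cg n))
  T-injective (suc m) {f} {g} _ cf cg e (+ n) = <-rec (λ n → f (+ n) ≈ g (+ n)) step n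
    where
    step : ∀ n → (∀ {k} → k < n → f (+ k) ≈ g (+ k)) → f (+ n) ≈ g (+ n)
    step n ih = -‿injective (begin
      - f (+ n)      ≈⟨ -1*x≈-x _ ⟨
      - 1# * f (+ n) ≈⟨ +-cancelˡ _ _ _ (trans (+-congʳ (sym (previous (n ℤ.⊖ suc m) ≡.refl))) (e (+ n))) ⟩
      - 1# * g (+ n) ≈⟨ -1*x≈-x _ ⟩
      - g (+ n)      ∎)
      where
      previous : ∀ i → n ℤ.⊖ suc m ≡ i → f i ≈ g i
      previous -[1+ k ] _  = trans (cf k) (sym (cg k))
      previous (+ k)    eq = ih (ℤ.drop‿+<+ (≡.subst (ℤ._< + n) eq (ℤ.m⊖1+n<m n (suc m))))

module ℤSeq = Sequences ℤ.+-*-commutativeRing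

-- Takes values in ℕ because it serves as the exponent of a linear factor in `Πʷ`.
indicator : ∀ {a} {A : Set a} → Dec A → ℕ
indicator a? = if does a? then 1 else 0

-- Products of linear factors and of binomials, acting on power series.

module Products {c ℓ} (R : CommutativeRing c ℓ) where
  open CommutativeRing R
  open import Algebra.Properties.Ring ring using (-‿distribʳ-*; -1*x≈-x; x∙y⁻¹≈ε⇒x≈y)
  open RawSemiringDefs (Semiring.rawSemiring semiring) using (_^_)
  open Relation.Binary.Reasoning.Setoid setoid
  open Sequences R
  open Algebra.Solver.Ring.NaturalCoefficients.Default commutativeSemiring
    using (solve; _:=_; _:+_; _:*_)

  open Polynomial rawRing

  ≋-refl : ∀ {f} → f ≋ f
  ≋-refl _ = refl

  ≋-sym : ∀ {f g} → f ≋ g → g ≋ f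
  ≋-sym e n = sym (e n)

  ≋-trans : ∀ {f g h} → f ≋ g → g ≋ h → f ≋ h
  ≋-trans e e′ n = trans (e n) (e′ n)

  ≡⇒≋ : ∀ {f g} → f ≡ g → f ≋ g
  ≡⇒≋ ≡.refl = ≋-refl

  Ts : List ℕ → Seq → Seq
  Ts ms f = foldr T f ms

  Ts-cong : ∀ ms {f g} → f ≋ g → Ts ms f ≋ Ts ms g
  Ts-cong []       e = e
  Ts-cong (m ∷ ms) e = T-cong m (Ts-cong ms e)

  Ts-comm : ∀ ms k v f → B k v (Ts ms f) ≋ Ts ms (B k v f)
  Ts-comm []       k v f = ≋-refl
  Ts-comm (m ∷ ms) k v f = ≋-trans (B-comm k v m (- 1#) (Ts ms f)) (T-cong m (Ts-comm ms k v f))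

  Ts-causal : ∀ ms f → Causal f → Causal (Ts ms f)
  Ts-causal []       f h = h
  Ts-causal (m ∷ ms) f h = B-causal m (- 1#) (Ts ms f) (Ts-causal ms f h)

  Ts-injective : ∀ {ms f g} → All (0 <_) ms → Causal f → Causal g → Ts ms f ≋ Ts ms g → f ≋ g
  Ts-injective           []         cf cg e = e
  Ts-injective {m ∷ ms} {f} {g} (0<m ∷ 0<ms) cf cg e = Ts-injective 0<ms cf cg
    (T-injective m 0<m (Ts-causal ms f cf) (Ts-causal ms g cg) e)

  Ts-↭ : ∀ {ms ns} f → ms ↭ ns → Ts ms f ≋ Ts ns f
  Ts-↭ f ↭.refl = ≋-refl
  Ts-↭ f (↭.prep m e) = T-cong m (Ts-↭ f e)
  Ts-↭ f (↭.swap {ms} m k e) = ≋-trans (T-comm m k (Ts ms f)) (T-cong k (T-cong m (Ts-↭ f e)))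
  Ts-↭ f (↭.trans e e′) = ≋-trans (Ts-↭ f e) (Ts-↭ f e′)

  Π : (ℕ → Carrier) → List ℕ → Seq → Seq
  Π ρ ks f = foldr (L ∘ ρ) f ks

  L-cong : ∀ {a b f g} → a ≈ b → f ≋ g → L a f ≋ L b g
  L-cong a≈b = B-cong 1 (-‿cong a≈b)

  L-comm : ∀ a b f → L a (L b f) ≋ L b (L a f)
  L-comm a b = B-comm 1 (- a) 1 (- b)

  Π-cong : ∀ ρ ks {f g} → f ≋ g → Π ρ ks f ≋ Π ρ ks g
  Π-cong ρ []       e = e
  Π-cong ρ (k ∷ ks) e = L-cong refl (Π-cong ρ ks e)

  Π-comm : ∀ ρ ks k v f → B k v (Π ρ ks f) ≋ Π ρ ks (B k v f)
  Π-comm ρ []       k v f = ≋-refl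
  Π-comm ρ (j ∷ ks) k v f = ≋-trans (B-comm k v 1 (- ρ j) (Π ρ ks f)) (L-cong refl (Π-comm ρ ks k v f))

  Π-Ts : ∀ ρ ks ms f → Π ρ ks (Ts ms f) ≋ Ts ms (Π ρ ks f)
  Π-Ts ρ ks []       f = ≋-refl
  Π-Ts ρ ks (m ∷ ms) f = ≋-trans (≋-sym (Π-comm ρ ks m (- 1#) (Ts ms f))) (T-cong m (Π-Ts ρ ks ms f))

  Π-↭ : ∀ ρ {ks ls} f → ks ↭ ls → Π ρ ks f ≋ Π ρ ls f
  Π-↭ ρ f ↭.refl = ≋-refl
  Π-↭ ρ f (↭.prep k e) = L-cong refl (Π-↭ ρ f e)
  Π-↭ ρ f (↭.swap {ks} k l e) = ≋-trans (L-comm (ρ k) (ρ l) (Π ρ ks f)) (L-cong refl (L-cong refl (Π-↭ ρ f e)))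
  Π-↭ ρ f (↭.trans e e′) = ≋-trans (Π-↭ ρ f e) (Π-↭ ρ f e′)

  infixr 8 _^ᴸ_
  _^ᴸ_ : Carrier → ℕ → Seq → Seq
  (a ^ᴸ zero)  f = f
  (a ^ᴸ suc n) f = L a ((a ^ᴸ n) f)

  -- Multiplicities live on one fixed list, so that products over different subsets merge by adding
  -- exponents and are compared pointwise.
  Πʷ : (ℕ → Carrier) → (ℕ → ℕ) → List ℕ → Seq → Seq
  Πʷ ρ w ks f = foldr (λ k → ρ k ^ᴸ w k) f ks

  ^ᴸ-cong : ∀ a n {f g} → f ≋ g → (a ^ᴸ n) f ≋ (a ^ᴸ n) g
  ^ᴸ-cong a zero    e = e
  ^ᴸ-cong a (suc n) e = L-cong refl (^ᴸ-cong a n e)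

  ^ᴸ-L : ∀ a n b f → L b ((a ^ᴸ n) f) ≋ (a ^ᴸ n) (L b f)
  ^ᴸ-L a zero    b f = ≋-refl
  ^ᴸ-L a (suc n) b f = ≋-trans (L-comm b a _) (L-cong refl (^ᴸ-L a n b f))

  ^ᴸ-+ : ∀ a m n f → (a ^ᴸ (m ℕ.+ n)) f ≋ (a ^ᴸ m) ((a ^ᴸ n) f)
  ^ᴸ-+ a zero    n f = ≋-refl
  ^ᴸ-+ a (suc m) n f = L-cong refl (^ᴸ-+ a m n f)

  Πʷ-L : ∀ ρ w ks b f → L b (Πʷ ρ w ks f) ≋ Πʷ ρ w ks (L b f)
  Πʷ-L ρ w []       b f = ≋-refl
  Πʷ-L ρ w (k ∷ ks) b f = ≋-trans (^ᴸ-L (ρ k) (w k) b _) (^ᴸ-cong (ρ k) (w k) (Πʷ-L ρ w ks b f))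

  Πʷ-cong : ∀ ρ w ks {f g} → f ≋ g → Πʷ ρ w ks f ≋ Πʷ ρ w ks g
  Πʷ-cong ρ w []       e = e
  Πʷ-cong ρ w (k ∷ ks) e = ^ᴸ-cong (ρ k) (w k) (Πʷ-cong ρ w ks e)

  Πʷ-^ᴸ : ∀ ρ w ks b n f → (b ^ᴸ n) (Πʷ ρ w ks f) ≋ Πʷ ρ w ks ((b ^ᴸ n) f)
  Πʷ-^ᴸ ρ w ks b zero    f = ≋-refl
  Πʷ-^ᴸ ρ w ks b (suc n) f = ≋-trans (L-cong refl (Πʷ-^ᴸ ρ w ks b n f)) (Πʷ-L ρ w ks b _)

  -- Linear factors commute, so the `v`-power at the head can be moved past the rest of the
  -- `w`-product.
  Πʷ-+ : ∀ ρ w v ks f → Πʷ ρ (λ k → w k ℕ.+ v k) ks f ≋ Πʷ ρ w ks (Πʷ ρ v ks f)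
  Πʷ-+ ρ w v []       f = ≋-refl
  Πʷ-+ ρ w v (k ∷ ks) f = ≋-trans (^ᴸ-+ (ρ k) (w k) (v k) _) (^ᴸ-cong (ρ k) (w k)
    (≋-trans (^ᴸ-cong (ρ k) (v k) (Πʷ-+ ρ w v ks f)) (Πʷ-^ᴸ ρ w ks (ρ k) (v k) _)))

  Πʷ-≡ : ∀ ρ {w v} ks f → (∀ k → w k ≡ v k) → Πʷ ρ w ks f ≡ Πʷ ρ v ks f
  Πʷ-≡ ρ []       f e = ≡.refl
  Πʷ-≡ ρ {v = v} (k ∷ ks) f e rewrite e k = cong (ρ k ^ᴸ v k) (Πʷ-≡ ρ ks f e)

  Π-filter : ∀ ρ {a} {A : ℕ → Set a} (A? : Decidable A) ks f → Π ρ (filter A? ks) f ≡ Πʷ ρ (indicator ∘ A?) ks f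
  Π-filter ρ A? []       f = ≡.refl
  Π-filter ρ A? (k ∷ ks) f with does (A? k)
  ... | true  = cong (L (ρ k)) (Π-filter ρ A? ks f)
  ... | false = Π-filter ρ A? ks f

  -- Indexed by an initial segment instead of a list, so that degree, leading coefficient and
  -- scaling of the roots are accessible by induction on the number of roots.
  Π< : (ℕ → Carrier) → ℕ → Seq → Seq
  Π< ρ zero    f = f
  Π< ρ (suc m) f = L (ρ 0) (Π< (ρ ∘ suc) m f)

  Π-map-upTo : ∀ ρ g m f → Π ρ (map g (upTo m)) f ≡ Π< (ρ ∘ g) m f
  Π-map-upTo ρ g m f = applied (λ i → i) m
    where
    -- `upTo` unfolds to `applyUpTo` of the identity, whose recursion replaces `h` by `h ∘ suc`;
    -- hence the general `h`.
    applied : ∀ h m → Π ρ (map g (applyUpTo h m)) f ≡ Π< (ρ ∘ g ∘ h) m f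
    applied h zero    = ≡.refl
    applied h (suc m) = cong (L (ρ (g (h 0)))) (applied (h ∘ suc) m)

  Π<-cong : ∀ {ρ σ} m f → (∀ k → ρ k ≈ σ k) → Π< ρ m f ≋ Π< σ m f
  Π<-cong zero    f e = ≋-refl
  Π<-cong (suc m) f e = L-cong (e 0) (Π<-cong m f (e ∘ suc))

  -- The recursion splits off the first root; commuting the factors lets the last one be split off
  -- instead. `Π<-powers` uses this to rotate the roots.
  Π<-last : ∀ ρ m f → Π< ρ (suc m) f ≋ L (ρ m) (Π< ρ m f)
  Π<-last ρ zero    f = ≋-refl
  Π<-last ρ (suc m) f = ≋-trans (L-cong refl (Π<-last (ρ ∘ suc) m f)) (L-comm (ρ 0) (ρ (suc m)) _)

  Π<-causal : ∀ ρ m → Causal (Π< ρ m δ)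
  Π<-causal ρ zero    = δ-causal
  Π<-causal ρ (suc m) = B-causal 1 (- ρ 0) (Π< (ρ ∘ suc) m δ) (Π<-causal (ρ ∘ suc) m)

  Π<-above : ∀ ρ m {n} → m < n → Π< ρ m δ (+ n) ≈ 0#
  Π<-above ρ zero    {suc n} _         = refl
  Π<-above ρ (suc m) {suc n} (s≤s m<n) =
    binomial-0 (- ρ 0) (Π<-above (ρ ∘ suc) m m<n) (Π<-above (ρ ∘ suc) m (ℕ.m≤n⇒m≤1+n m<n))

  Π<-leading : ∀ ρ m → Π< ρ m δ (+ m) ≈ 1#
  Π<-leading ρ zero    = refl
  Π<-leading ρ (suc m) = begin
    Π< (ρ ∘ suc) m δ (+ m) + - ρ 0 * Π< (ρ ∘ suc) m δ (+ suc m)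
      ≈⟨ +-cong (Π<-leading (ρ ∘ suc) m) (*-congˡ (Π<-above (ρ ∘ suc) m ℕ.≤-refl)) ⟩
    1# + - ρ 0 * 0#  ≈⟨ +-congˡ (zeroʳ _) ⟩
    1# + 0#          ≈⟨ +-identityʳ 1# ⟩
    1#               ∎

  -- ∏ (ηx - ηρₖ) = ηᵐ ∏ (x - ρₖ), read off on coefficients.
  Π<-scale : ∀ η ρ m n → η ^ n * Π< (λ k → η * ρ k) m δ (+ n) ≈ η ^ m * Π< ρ m δ (+ n)
  Π<-scale η ρ zero    zero    = refl
  Π<-scale η ρ zero    (suc n) = trans (zeroʳ _) (sym (zeroʳ _))
  Π<-scale η ρ (suc m) n = begin
    η ^ n * (f (+ n ℤ.- 1ℤ) + - (η * ρ 0) * f (+ n))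
      ≈⟨ *-congˡ (+-congˡ (*-congʳ (-‿distribʳ-* η (ρ 0)))) ⟩
    η ^ n * (f (+ n ℤ.- 1ℤ) + η * - ρ 0 * f (+ n))
      ≈⟨ solve 5 (λ e x η a z → e :* (x :+ η :* a :* z) := e :* x :+ η :* a :* (e :* z)) refl _ _ η (- ρ 0) _ ⟩
    η ^ n * f (+ n ℤ.- 1ℤ) + η * - ρ 0 * (η ^ n * f (+ n))
      ≈⟨ +-cong (previous n) (*-congˡ (Π<-scale η (ρ ∘ suc) m n)) ⟩
    η ^ suc m * g (+ n ℤ.- 1ℤ) + η * - ρ 0 * (η ^ m * g (+ n))
      ≈⟨ solve 5 (λ e x η a z → η :* e :* x :+ η :* a :* (e :* z) := η :* e :* (x :+ a :* z)) refl (η ^ m) _ η (- ρ 0) _ ⟩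
    η ^ suc m * (g (+ n ℤ.- 1ℤ) + - ρ 0 * g (+ n)) ∎
    where
    f = Π< (λ k → η * ρ (suc k)) m δ
    g = Π< (ρ ∘ suc) m δ
    -- At n = 0 the index n - 1 is negative and both products vanish there; otherwise the induction
    -- hypothesis is multiplied by η.
    previous : ∀ n → η ^ n * f (+ n ℤ.- 1ℤ) ≈ η ^ suc m * g (+ n ℤ.- 1ℤ)
    previous zero = trans (trans (*-congˡ (Π<-causal (λ k → η * ρ (suc k)) m 0)) (zeroʳ _))
      (sym (trans (*-congˡ (Π<-causal (ρ ∘ suc) m 0)) (zeroʳ _)))
    previous (suc n) = trans (*-assoc η (η ^ n) _) (trans (*-congˡ (Π<-scale η (ρ ∘ suc) m n)) (sym (*-assoc η (η ^ m) _)))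

  δ-shift< : ∀ {n m} → n < m → δ (n ℤ.⊖ m) ≡ 0#
  δ-shift< {n} {m} n<m rewrite ℤ.⊖-< n<m with m ℕ.∸ n | ℕ.m<n⇒0<n∸m n<m
  ... | suc _ | _ = ≡.refl

  δ-shift> : ∀ {n m} → m < n → δ (n ℤ.⊖ m) ≡ 0#
  δ-shift> {n} {m} m<n rewrite ℤ.⊖-≥ (ℕ.<⇒≤ m<n) with n ℕ.∸ m | ℕ.m<n⇒0<n∸m m<n
  ... | suc _ | _ = ≡.refl

  -- P(ηx) = P(x) forces the middle coefficients of P to vanish, and P(1) = 0 gives the constant one.
  Π<-powers : ∀ η m → η ^ suc m ≈ 1# → (∀ n x → 0 < n → n < suc m → η ^ n * x ≈ x → x ≈ 0#) →
              Π< (η ^_) (suc m) δ ≋ T (suc m) δ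
  Π<-powers η m η^m≈1 cancel = agree
    where
    P Q : Seq
    P = Π< (η ^_) (suc m) δ
    Q = Π< (λ k → η * η ^ k) m δ

    -- Multiplying all roots by η drops the first root η⁰ = 1 and adds a last root equal to ηᵐ⁺¹ =
    -- 1.
    rotate : Π< (λ k → η * η ^ k) (suc m) δ ≋ P
    rotate = ≋-trans (Π<-last (λ k → η * η ^ k) m δ) (L-cong η^m≈1 ≋-refl)

    invariant : ∀ n → η ^ n * P (+ n) ≈ P (+ n)
    invariant n = begin
      η ^ n * P (+ n)                                ≈⟨ *-congˡ (rotate (+ n)) ⟨
      η ^ n * Π< (λ k → η * η ^ k) (suc m) δ (+ n)   ≈⟨ Π<-scale η (η ^_) (suc m) n ⟩
      η ^ suc m * P (+ n)                            ≈⟨ *-congʳ η^m≈1 ⟩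
      1# * P (+ n)                                   ≈⟨ *-identityˡ _ ⟩
      P (+ n)                                        ∎

    middle : ∀ n → n < m → P (+ suc n) ≈ 0#
    middle n n<m = cancel (suc n) _ (s≤s z≤n) (s≤s n<m) (invariant (suc n))

    -- P unfolds to (x - 1) Q, so a vanishing middle coefficient of P makes two neighbouring
    -- coefficients of Q equal.
    Q-constant : ∀ n → n ≤ m → Q 0ℤ ≈ Q (+ n)
    Q-constant zero    _   = refl
    Q-constant (suc n) n<m = trans (Q-constant n (ℕ.<⇒≤ n<m)) (x∙y⁻¹≈ε⇒x≈y _ _
      (trans (+-congˡ (sym (-1*x≈-x _))) (middle n n<m)))

    agree : P ≋ T (suc m) δ
    agree -[1+ n ] = trans (Π<-causal (η ^_) (suc m) n) (sym (B-causal (suc m) (- 1#) δ δ-causal n))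
    -- The constant term of P is minus that of Q, and by `Q-constant` the latter equals the leading
    -- coefficient 1 of Q.
    agree (+ zero) = +-cong (Π<-causal (λ k → η * η ^ k) m 0)
      (*-congˡ (trans (Q-constant m ℕ.≤-refl) (Π<-leading (λ k → η * η ^ k) m)))
    agree (+ suc n) with ℕ.<-cmp n m
    ... | tri< n<m _ _ = trans (middle n n<m) 
      (sym (binomial-0 (- 1#) (reflexive (δ-shift< (s≤s n<m))) refl))
    ... | tri> _ _ n>m = trans (Π<-above (η ^_) (suc m) (s≤s n>m)) 
      (sym (binomial-0 (- 1#) (reflexive (δ-shift> (s≤s n>m))) refl))
    ... | tri≈ _ ≡.refl _ = begin
      P (+ suc m)                                     ≈⟨ Π<-leading (η ^_) (suc m) ⟩
      1#                                              ≈⟨ +-identityʳ 1# ⟨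
      1# + 0#                                         ≈⟨ +-cong (reflexive (cong δ (ℤ.n⊖n≡0 (suc m)))) (zeroʳ (- 1#)) ⟨
      δ (suc m ℤ.⊖ suc m) + - 1# * 0#                 ∎

  Π-Ts-δ : ∀ ρ ks m ms → Π ρ ks δ ≋ T m δ → Π ρ ks (Ts ms δ) ≋ Ts (m ∷ ms) δ
  Π-Ts-δ ρ ks m ms e = ≋-trans (Π-Ts ρ ks ms δ) (≋-trans (Ts-cong ms e) (≋-sym (Ts-comm ms m (- 1#) δ)))

  -- From coefficient lists to operators on power series.

  coeffℕ-+ : ∀ f g n → coeffℕ (f +ₚ g) n ≈ coeffℕ f n + coeffℕ g n
  coeffℕ-+ []      g       n       = sym (+-identityˡ _)
  coeffℕ-+ (a ∷ f) []      n       = sym (+-identityʳ _)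
  coeffℕ-+ (a ∷ f) (b ∷ g) zero    = refl
  coeffℕ-+ (a ∷ f) (b ∷ g) (suc n) = coeffℕ-+ f g n

  coeffℕ-map : ∀ a f n → coeffℕ (map (a *_) f) n ≈ a * coeffℕ f n
  coeffℕ-map a []      n       = sym (zeroʳ a)
  coeffℕ-map a (b ∷ f) zero    = refl
  coeffℕ-map a (b ∷ f) (suc n) = coeffℕ-map a f n

  coeff-L : ∀ a f → coeff ((X- a) *ₚ f) ≋ L a (coeff f)
  coeff-L a f -[1+ n ] = sym (binomial-0 (- a) refl refl)
  coeff-L a f (+ zero) = begin
    coeffℕ (map (- a *_) f +ₚ (0# ∷ (1# ∷ []) *ₚ f)) 0 ≈⟨ coeffℕ-+ (map (- a *_) f) _ 0 ⟩
    coeffℕ (map (- a *_) f) 0 + 0#                     ≈⟨ +-comm _ _ ⟩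
    0# + coeffℕ (map (- a *_) f) 0                     ≈⟨ +-congˡ (coeffℕ-map (- a) f 0) ⟩
    0# + - a * coeffℕ f 0                              ∎
  coeff-L a f (+ suc n) = begin
    coeffℕ (map (- a *_) f +ₚ (0# ∷ (1# ∷ []) *ₚ f)) (suc n)
      ≈⟨ coeffℕ-+ (map (- a *_) f) _ (suc n) ⟩
    coeffℕ (map (- a *_) f) (suc n) + coeffℕ ((1# ∷ []) *ₚ f) n
      -- The tail `1# ∷ []` of the linear factor contributes `f` itself and a padding `0# ∷ []`.
      ≈⟨ +-cong (coeffℕ-map (- a) f (suc n)) (coeffℕ-+ (map (1# *_) f) (0# ∷ []) n) ⟩
    - a * coeffℕ f (suc n) + (coeffℕ (map (1# *_) f) n + coeffℕ (0# ∷ []) n)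
      ≈⟨ +-congˡ (+-cong (trans (coeffℕ-map 1# f n) (*-identityˡ _)) (zero-coeff n)) ⟩
    - a * coeffℕ f (suc n) + (coeffℕ f n + 0#)
      ≈⟨ +-congˡ (+-identityʳ _) ⟩
    - a * coeffℕ f (suc n) + coeffℕ f n
      ≈⟨ +-comm _ _ ⟩
    coeffℕ f n + - a * coeffℕ f (suc n) ∎
    where
    zero-coeff : ∀ n → coeffℕ (0# ∷ []) n ≈ 0#
    zero-coeff zero    = refl
    zero-coeff (suc n) = refl

  -- The empty product is the constant 1, whose series is `δ`, and `coeff-L` handles each factor.
  -- This turns `Φ` into an operator applied to `δ`.
  coeff-∏ₚ : ∀ ρ ks → coeff (∏ₚ (map (λ k → X- ρ k) ks)) ≋ Π ρ ks δ
  coeff-∏ₚ ρ []       (+ zero)  = refl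
  coeff-∏ₚ ρ []       (+ suc _) = refl
  coeff-∏ₚ ρ []       -[1+ _ ]  = refl
  coeff-∏ₚ ρ (k ∷ ks) = ≋-trans (coeff-L (ρ k) _) (L-cong refl (coeff-∏ₚ ρ ks))

module ℤProd = Products ℤ.+-*-commutativeRing

-- Mixed-radix coordinates

-- A common divisor of k and mn is itself coprime to m, hence divides n.
coprime-*ˡ : ∀ {k m n} → Coprime k m → Coprime k n → Coprime k (m ℕ.* n)
coprime-*ˡ {k} {m} {n} km kn {d} (d∣k , d∣mn) = kn (d∣k , coprime-divisor dm d∣mn)
  where
  dm : Coprime d m
  dm (e∣d , e∣m) = km (∣-trans e∣d d∣k , e∣m)

bézout : ∀ {m n} → Coprime m n → ∃₂ λ x y → x ℤ.* + m ℤ.+ y ℤ.* + n ≡ 1ℤ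
bézout {m} {n} m⊥n with coprime-Bézout m⊥n
... | Bézout.+- x y eq = + x , ℤ.- + y , (begin
  + x * + m + - + y * + n             ≡⟨ cong (_+ - + y * + n) (≡.trans (≡.sym (ℤ.pos-* x m)) (cong +_ (≡.sym eq))) ⟩
  + (1 ℕ.+ y ℕ.* n) + - + y * + n     ≡⟨ cong (λ z → 1ℤ + z + - + y * + n) (ℤ.pos-* y n) ⟩
  1ℤ + + y * + n + - + y * + n        ≡⟨ cancel (+ y) (+ n) ⟩
  1ℤ                                  ∎)
  where
  open ≡-Reasoning
  open import Data.Integer.Base using (_+_; _*_; -_)
  cancel : ∀ y n → 1ℤ + y * n + - y * n ≡ 1ℤ
  cancel = solve-∀
... | Bézout.-+ x y eq = ℤ.- + x , + y , (begin
  - + x * + m + + y * + n             ≡⟨ cong (λ z → - + x * + m + z) (≡.trans (≡.sym (ℤ.pos-* y n)) (cong +_ (≡.sym eq))) ⟩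
  - + x * + m + + (1 ℕ.+ x ℕ.* m)     ≡⟨ cong (λ z → - + x * + m + (1ℤ + z)) (ℤ.pos-* x m) ⟩
  - + x * + m + (1ℤ + + x * + m)      ≡⟨ cancel (+ x) (+ m) ⟩
  1ℤ                                  ∎)
  where
  open ≡-Reasoning
  open import Data.Integer.Base using (_+_; _*_; -_)
  cancel : ∀ x m → - x * m + (1ℤ + x * m) ≡ 1ℤ
  cancel = solve-∀

-- Since k is coprime to m, m divides a - b, while |a - b| < m.
residue-unique : ∀ {m k a b} t → Coprime m k → a < m → b < m →
                 (+ a ℤ.- + b) ℤ.* + k ≡ t ℤ.* + m → a ≡ b
residue-unique {m} {k} {a} {b} t m⊥k a<m b<m eq = ℤ.+-injective (ℤ.i-j≡0⇒i≡j (+ a) (+ b) (ℤ.∣i∣≡0⇒i≡0 small))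
  where
  m∣a-b : m ∣ ∣ + a ℤ.- + b ∣
  m∣a-b = coprime-divisor m⊥k (divides ∣ t ∣ (begin
    k ℕ.* ∣ + a ℤ.- + b ∣     ≡⟨ ℕ.*-comm k _ ⟩
    ∣ + a ℤ.- + b ∣ ℕ.* k     ≡⟨ ℤ.abs-* (+ a ℤ.- + b) (+ k) ⟨
    ∣ (+ a ℤ.- + b) ℤ.* + k ∣ ≡⟨ cong ∣_∣ eq ⟩
    ∣ t ℤ.* + m ∣             ≡⟨ ℤ.abs-* t (+ m) ⟩
    ∣ t ∣ ℕ.* m               ∎))
    where open ≡-Reasoning
  a-b<m : ∣ + a ℤ.- + b ∣ < m
  a-b<m = ℕ.≤-<-trans (subst (λ z → ∣ z ∣ ≤ a ℕ.⊔ b) (≡.sym (ℤ.m-n≡m⊖n a b)) (ℤ.∣m⊝n∣≤m⊔n a b)) (ℕ.⊔-lub a<m b<m)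
  small : ∣ + a ℤ.- + b ∣ ≡ 0
  small with ∣ + a ℤ.- + b ∣ | a-b<m | m∣a-b
  ... | zero  | _  | _  = ≡.refl
  ... | suc _ | lt | m∣ = contradiction (∣⇒≤ m∣) (ℕ.<⇒≱ lt)

bit : Bool → ℤ
bit true  = 1ℤ
bit false = 0ℤ

-- Subtraction of single digits in base m; the bit is the borrow, which will be charged to κ.
borrow : ∀ {m a b} → a < m → b < m →
         ∃ λ c → c < m × + a ℤ.- + b ≡ + c ℤ.- bit (a ℕ.<ᵇ b) ℤ.* + m
borrow {m} {a} {b} a<m b<m with a ℕ.<ᵇ b | ℕ.<ᵇ-reflects-< a b
... | true  | ofʸ a<b = a ℕ.+ m ∸ b , lt , eq
  where
  b≤a+m : b ≤ a ℕ.+ m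
  b≤a+m = ℕ.≤-trans (ℕ.<⇒≤ b<m) (ℕ.m≤n+m m a)
  lt : a ℕ.+ m ∸ b < m
  lt = ℕ.+-cancelʳ-< b _ _ (subst₂ _<_ (≡.sym (ℕ.m∸n+n≡m b≤a+m)) (ℕ.+-comm b m) (ℕ.+-monoˡ-< m a<b))
  rearrange : ∀ a b m → a ℤ.- b ≡ a ℤ.+ m ℤ.- b ℤ.- 1ℤ ℤ.* m
  rearrange = solve-∀
  eq : + a ℤ.- + b ≡ + (a ℕ.+ m ∸ b) ℤ.- 1ℤ ℤ.* + m
  eq = ≡.trans (rearrange (+ a) (+ b) (+ m))
    (cong (ℤ._- 1ℤ ℤ.* + m) (≡.trans (ℤ.m-n≡m⊖n (a ℕ.+ m) b) (ℤ.⊖-≥ b≤a+m)))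
... | false | ofⁿ a≮b = a ∸ b , ℕ.≤-<-trans (ℕ.m∸n≤m a b) a<m ,
  ≡.trans (ℤ.m-n≡m⊖n a b) (≡.trans (ℤ.⊖-≥ (ℕ.≮⇒≥ a≮b)) (≡.sym (ℤ.+-identityʳ _)))

suc⁺ : ℤ → ℤ
suc⁺ (+ k)    = + suc k
suc⁺ -[1+ _ ] = 0ℤ

-- The bounds on the digits are kept apart in `Valid`, so that lowering a digit is a plain function.
record Digits : Set where
  constructor ⟨_,_,_,_⟩
  field
    α β γ : ℕ
    κ     : ℤ

module Coordinates (p q r : ℕ) {{_ : NonZero p}} {{_ : NonZero q}} {{_ : NonZero r}}
  (p⊥q : Coprime p q) (p⊥r : Coprime p r) (q⊥r : Coprime q r) where

  open import Data.Integer.Base using (_+_; _*_; _-_; -_)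
  open ≡-Reasoning

  r⊥pq : Coprime r (p ℕ.* q)
  r⊥pq = coprime-*ˡ {r} {p} {q} (Coprime.sym {p} {r} p⊥r) (Coprime.sym {q} {r} q⊥r)

  value : Digits → ℤ
  value ⟨ α , β , γ , κ ⟩ =
    + α * (+ p * + q) + + β * (+ p * + r) + + γ * (+ q * + r) + κ * (+ p * + q * + r)

  Valid : Digits → Set
  Valid ⟨ α , β , γ , κ ⟩ = α < r × β < q × γ < p

  open Digits

  private
    factor : ∀ t s m → t * m - s * m ≡ (t - s) * m
    factor = solve-∀

  -- Modulo r only the term α pq survives, and pq is coprime to r. With t = 0 this gives uniqueness
  -- of the digit, with t = 1 its invariance under a shift by r. The same holds for β modulo q and γ
  -- modulo p.
  α-cong : ∀ {d e} → Valid d → Valid e → ∀ t → value d - value e ≡ t * + r → α d ≡ α e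
  α-cong {d} {e} (α< , _) (α′< , _) t eq = residue-unique (t - rest)
    r⊥pq α< α′<
    (≡.trans (cong ((+ α d - + α e) *_) (ℤ.pos-* p q))
      (≡.trans (isolate (+ α d) (+ β d) (+ γ d) (κ d) (+ α e) (+ β e) (+ γ e) (κ e) (+ p) (+ q) (+ r))
        (≡.trans (cong (_- rest * + r) eq) (factor t rest (+ r)))))
    where
    rest = (+ β d - + β e) * + p + (+ γ d - + γ e) * + q + (κ d - κ e) * (+ p * + q)
    isolate : ∀ a b c k a′ b′ c′ k′ p q r → (a - a′) * (p * q) ≡
      a * (p * q) + b * (p * r) + c * (q * r) + k * (p * q * r)
      - (a′ * (p * q) + b′ * (p * r) + c′ * (q * r) + k′ * (p * q * r))
      - ((b - b′) * p + (c - c′) * q + (k - k′) * (p * q)) * r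
    isolate = solve-∀

  β-cong : ∀ {d e} → Valid d → Valid e → ∀ t → value d - value e ≡ t * + q → β d ≡ β e
  β-cong {d} {e} (_ , β< , _) (_ , β′< , _) t eq = residue-unique (t - rest)
    (coprime-*ˡ {q} {p} {r} (Coprime.sym {p} {q} p⊥q) q⊥r) β< β′<
    (≡.trans (cong ((+ β d - + β e) *_) (ℤ.pos-* p r))
      (≡.trans (isolate (+ α d) (+ β d) (+ γ d) (κ d) (+ α e) (+ β e) (+ γ e) (κ e) (+ p) (+ q) (+ r))
        (≡.trans (cong (_- rest * + q) eq) (factor t rest (+ q)))))
    where
    rest = (+ α d - + α e) * + p + (+ γ d - + γ e) * + r + (κ d - κ e) * (+ p * + r)
    isolate : ∀ a b c k a′ b′ c′ k′ p q r → (b - b′) * (p * r) ≡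
      a * (p * q) + b * (p * r) + c * (q * r) + k * (p * q * r)
      - (a′ * (p * q) + b′ * (p * r) + c′ * (q * r) + k′ * (p * q * r))
      - ((a - a′) * p + (c - c′) * r + (k - k′) * (p * r)) * q
    isolate = solve-∀

  γ-cong : ∀ {d e} → Valid d → Valid e → ∀ t → value d - value e ≡ t * + p → γ d ≡ γ e
  γ-cong {d} {e} (_ , _ , γ<) (_ , _ , γ′<) t eq = residue-unique (t - rest)
    (coprime-*ˡ {p} {q} {r} p⊥q p⊥r) γ< γ′<
    (≡.trans (cong ((+ γ d - + γ e) *_) (ℤ.pos-* q r))
      (≡.trans (isolate (+ α d) (+ β d) (+ γ d) (κ d) (+ α e) (+ β e) (+ γ e) (κ e) (+ p) (+ q) (+ r))
        (≡.trans (cong (_- rest * + p) eq) (factor t rest (+ p)))))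
    where
    rest = (+ α d - + α e) * + q + (+ β d - + β e) * + r + (κ d - κ e) * (+ q * + r)
    isolate : ∀ a b c k a′ b′ c′ k′ p q r → (c - c′) * (q * r) ≡
      a * (p * q) + b * (p * r) + c * (q * r) + k * (p * q * r)
      - (a′ * (p * q) + b′ * (p * r) + c′ * (q * r) + k′ * (p * q * r))
      - ((a - a′) * q + (b - b′) * r + (k - k′) * (q * r)) * p
    isolate = solve-∀

  +pqr≢0 : ℤ.NonZero (+ p * + q * + r)
  +pqr≢0 = ℤ.i*j≢0 (+ p * + q) (+ r) {{ℤ.i*j≢0 (+ p) (+ q)}}

  value-injective : ∀ {d e} → Valid d → Valid e → value d ≡ value e → d ≡ e
  value-injective {d} {e} vd ve eq =
    combine (α-cong {d} {e} vd ve 0ℤ eq′) (β-cong {d} {e} vd ve 0ℤ eq′) (γ-cong {d} {e} vd ve 0ℤ eq′) eq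
    where
    eq′ : value d - value e ≡ 0ℤ
    eq′ = ℤ.i≡j⇒i-j≡0 {value d} eq
    combine : ∀ {d e} → α d ≡ α e → β d ≡ β e → γ d ≡ γ e → value d ≡ value e → d ≡ e
    combine {⟨ α , β , γ , κ ⟩} {⟨ _ , _ , _ , κ′ ⟩} ≡.refl ≡.refl ≡.refl eq =
      cong ⟨ α , β , γ ,_⟩ (ℤ.*-cancelʳ-≡ κ κ′ (+ p * + q * + r) {{+pqr≢0}}
        (ℤ-+-cancelˡ (+ α * (+ p * + q) + + β * (+ p * + r) + + γ * (+ q * + r)) _ _ eq))

  abstract
    -- From xp + yq = 1 and z pq + w r = 1 follows 1 = z pq + wx pr + wy qr. Multiply by n, reduce
    -- the three coefficients modulo r, q and p, and collect the quotients in κ. It is abstract, so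
    -- that `digits n` never unfolds and is known only through validity and value.
    representation : ∀ n → ∃ λ d → Valid d × value d ≡ n
    representation n with bézout {p} {q} p⊥q | bézout {p ℕ.* q} {r} (Coprime.sym {r} {p ℕ.* q} r⊥pq)
    ... | x , y , xp+yq≡1 | z , w , zpq+wr≡1 =
      ⟨ a %ℕ r , b %ℕ q , c %ℕ p , a /ℕ r + b /ℕ q + c /ℕ p ⟩ ,
      (n%ℕd<d a r , n%ℕd<d b q , n%ℕd<d c p) ,
      (begin
        + (a %ℕ r) * (+ p * + q) + + (b %ℕ q) * (+ p * + r) + + (c %ℕ p) * (+ q * + r)
          + (a /ℕ r + b /ℕ q + c /ℕ p) * (+ p * + q * + r)
          ≡⟨ regroup (+ (a %ℕ r)) (a /ℕ r) (+ (b %ℕ q)) (b /ℕ q) (+ (c %ℕ p)) (c /ℕ p) (+ p) (+ q) (+ r) ⟩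
        (+ (a %ℕ r) + a /ℕ r * + r) * (+ p * + q) + (+ (b %ℕ q) + b /ℕ q * + q) * (+ p * + r)
          + (+ (c %ℕ p) + c /ℕ p * + p) * (+ q * + r)
          ≡⟨ cong₂ _+_ (cong₂ _+_ (cong (_* (+ p * + q)) (a≡a%ℕn+[a/ℕn]*n a r))
                                 (cong (_* (+ p * + r)) (a≡a%ℕn+[a/ℕn]*n b q)))
                       (cong (_* (+ q * + r)) (a≡a%ℕn+[a/ℕn]*n c p)) ⟨
        a * (+ p * + q) + b * (+ p * + r) + c * (+ q * + r)
          ≡⟨ collect n x y z w (+ p) (+ q) (+ r) ⟩
        n * (z * (+ p * + q) + w * + r * (x * + p + y * + q))
          ≡⟨ cong (λ i → n * (z * (+ p * + q) + w * + r * i)) xp+yq≡1 ⟩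
        n * (z * (+ p * + q) + w * + r * 1ℤ)
          ≡⟨ cong (n *_) (≡.trans (cong₂ _+_ (cong (z *_) (≡.sym (ℤ.pos-* p q))) (ℤ.*-identityʳ (w * + r))) zpq+wr≡1) ⟩
        n * 1ℤ
          ≡⟨ ℤ.*-identityʳ n ⟩
        n ∎)
      where
      a b c : ℤ
      a = n * z
      b = n * (w * x)
      c = n * (w * y)
      regroup : ∀ a a′ b b′ c c′ p q r →
        a * (p * q) + b * (p * r) + c * (q * r) + (a′ + b′ + c′) * (p * q * r) ≡
        (a + a′ * r) * (p * q) + (b + b′ * q) * (p * r) + (c + c′ * p) * (q * r)
      regroup = solve-∀
      collect : ∀ n x y z w p q r →
        n * z * (p * q) + n * (w * x) * (p * r) + n * (w * y) * (q * r) ≡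
        n * (z * (p * q) + w * r * (x * p + y * q))
      collect = solve-∀

  digits : ℤ → Digits
  digits n = proj₁ (representation n)

  digits-valid : ∀ n → Valid (digits n)
  digits-valid n = proj₁ (proj₂ (representation n))

  value-digits : ∀ n → value (digits n) ≡ n
  value-digits n = proj₂ (proj₂ (representation n))

  digits-unique : ∀ {d n} → Valid d → value d ≡ n → digits n ≡ d
  digits-unique {d} {n} v eq = value-injective (digits-valid n) v (≡.trans (value-digits n) (≡.sym eq))

  open ℤSeq

  -- `M n` counts the solutions of n = a pq + b pr + c qr in natural numbers with a < r: a is the
  -- digit α, and b, c exceed β, γ by iq, jp with i + j = κ.
  M : Seq
  M n = suc⁺ (κ (digits n))

  value-nonNegative : ∀ a b c k → ∃ λ n → value ⟨ a , b , c , + k ⟩ ≡ + n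
  value-nonNegative a b c k =
    a ℕ.* (p ℕ.* q) ℕ.+ b ℕ.* (p ℕ.* r) ℕ.+ c ℕ.* (q ℕ.* r) ℕ.+ k ℕ.* (p ℕ.* q ℕ.* r) , ≡.sym (begin
    + (a ℕ.* (p ℕ.* q) ℕ.+ b ℕ.* (p ℕ.* r) ℕ.+ c ℕ.* (q ℕ.* r) ℕ.+ k ℕ.* (p ℕ.* q ℕ.* r))
      ≡⟨⟩
    + (a ℕ.* (p ℕ.* q)) + + (b ℕ.* (p ℕ.* r)) + + (c ℕ.* (q ℕ.* r)) + + (k ℕ.* (p ℕ.* q ℕ.* r))
      ≡⟨ cong₂ _+_ (cong₂ _+_ (cong₂ _+_ (pos-** a p q) (pos-** b p r)) (pos-** c q r))
                   (≡.trans (ℤ.pos-* k (p ℕ.* q ℕ.* r))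
                     (cong (+ k *_) (≡.trans (ℤ.pos-* (p ℕ.* q) r) (cong (_* + r) (ℤ.pos-* p q))))) ⟩
    value ⟨ a , b , c , + k ⟩ ∎)
    where
    pos-** : ∀ x y z → + (x ℕ.* (y ℕ.* z)) ≡ + x * (+ y * + z)
    pos-** x y z = ≡.trans (ℤ.pos-* x (y ℕ.* z)) (cong (+ x *_) (ℤ.pos-* y z))

  -- If κ were non-negative, the value would be a sum of non-negative terms; so negative integers
  -- have κ < 0.
  M-causal : Causal M
  M-causal n = negative (digits -[1+ n ]) (value-digits -[1+ n ])
    where
    negative : ∀ d → value d ≡ -[1+ n ] → suc⁺ (κ d) ≡ 0ℤ
    negative ⟨ _ , _ , _ , -[1+ _ ] ⟩ _  = ≡.refl
    negative ⟨ a , b , c , + k ⟩      eq with () ← ≡.trans (≡.sym (proj₂ (value-nonNegative a b c k))) eq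

  -- A zero digit wraps around to its maximum and borrows from κ, because r · pq = q · pr = p · qr =
  -- pqr.
  ↓α ↓β ↓γ ↓κ : Digits → Digits
  ↓α ⟨ zero  , β , γ , κ ⟩ = ⟨ ℕ.pred r , β , γ , κ - 1ℤ ⟩
  ↓α ⟨ suc α , β , γ , κ ⟩ = ⟨ α , β , γ , κ ⟩
  ↓β ⟨ α , zero  , γ , κ ⟩ = ⟨ α , ℕ.pred q , γ , κ - 1ℤ ⟩
  ↓β ⟨ α , suc β , γ , κ ⟩ = ⟨ α , β , γ , κ ⟩
  ↓γ ⟨ α , β , zero  , κ ⟩ = ⟨ α , β , ℕ.pred p , κ - 1ℤ ⟩
  ↓γ ⟨ α , β , suc γ , κ ⟩ = ⟨ α , β , γ , κ ⟩
  ↓κ ⟨ α , β , γ , κ ⟩ = ⟨ α , β , γ , κ - 1ℤ ⟩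

  pred< : ∀ m {{_ : NonZero m}} → ℕ.pred m < m
  pred< (suc m) = ℕ.≤-refl

  +pred : ∀ m {{_ : NonZero m}} → + ℕ.pred m ≡ + m - 1ℤ
  +pred (suc m) = ≡.refl

  ↓α-valid : ∀ d → Valid d → Valid (↓α d)
  ↓α-valid ⟨ zero  , _ , _ , _ ⟩ (_ , v)  = pred< r , v
  ↓α-valid ⟨ suc _ , _ , _ , _ ⟩ (α< , v) = ℕ.<⇒≤ α< , v

  ↓β-valid : ∀ d → Valid d → Valid (↓β d)
  ↓β-valid ⟨ _ , zero  , _ , _ ⟩ (u , _ , v)  = u , pred< q , v
  ↓β-valid ⟨ _ , suc _ , _ , _ ⟩ (u , β< , v) = u , ℕ.<⇒≤ β< , v

  ↓γ-valid : ∀ d → Valid d → Valid (↓γ d)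
  ↓γ-valid ⟨ _ , _ , zero  , _ ⟩ (u , v , _)  = u , v , pred< p
  ↓γ-valid ⟨ _ , _ , suc _ , _ ⟩ (u , v , γ<) = u , v , ℕ.<⇒≤ γ<

  value-↓α : ∀ d → value (↓α d) ≡ value d - + (p ℕ.* q)
  value-↓α ⟨ zero  , b , c , k ⟩ =
    ≡.trans (cong (λ a → a * (+ p * + q) + + b * (+ p * + r) + + c * (+ q * + r) + (k - 1ℤ) * (+ p * + q * + r)) (+pred r))
      (≡.trans (lemma (+ b) (+ c) k (+ p) (+ q) (+ r)) (cong (λ z → value ⟨ 0 , b , c , k ⟩ - z) (≡.sym (ℤ.pos-* p q))))
    where
    lemma : ∀ b c k p q r →
      (r - 1ℤ) * (p * q) + b * (p * r) + c * (q * r) + (k - 1ℤ) * (p * q * r) ≡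
      0ℤ * (p * q) + b * (p * r) + c * (q * r) + k * (p * q * r) - p * q
    lemma = solve-∀
  value-↓α ⟨ suc a , b , c , k ⟩ =
    ≡.trans (lemma (+ a) (+ b) (+ c) k (+ p) (+ q) (+ r)) (cong (λ z → value ⟨ suc a , b , c , k ⟩ - z) (≡.sym (ℤ.pos-* p q)))
    where
    lemma : ∀ a b c k p q r →
      a * (p * q) + b * (p * r) + c * (q * r) + k * (p * q * r) ≡
      (1ℤ + a) * (p * q) + b * (p * r) + c * (q * r) + k * (p * q * r) - p * q
    lemma = solve-∀

  value-↓β : ∀ d → value (↓β d) ≡ value d - + (p ℕ.* r)
  value-↓β ⟨ a , zero  , c , k ⟩ =
    ≡.trans (cong (λ b → + a * (+ p * + q) + b * (+ p * + r) + + c * (+ q * + r) + (k - 1ℤ) * (+ p * + q * + r)) (+pred q))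
      (≡.trans (lemma (+ a) (+ c) k (+ p) (+ q) (+ r)) (cong (λ z → value ⟨ a , 0 , c , k ⟩ - z) (≡.sym (ℤ.pos-* p r))))
    where
    lemma : ∀ a c k p q r →
      a * (p * q) + (q - 1ℤ) * (p * r) + c * (q * r) + (k - 1ℤ) * (p * q * r) ≡
      a * (p * q) + 0ℤ * (p * r) + c * (q * r) + k * (p * q * r) - p * r
    lemma = solve-∀
  value-↓β ⟨ a , suc b , c , k ⟩ =
    ≡.trans (lemma (+ a) (+ b) (+ c) k (+ p) (+ q) (+ r)) (cong (λ z → value ⟨ a , suc b , c , k ⟩ - z) (≡.sym (ℤ.pos-* p r)))
    where
    lemma : ∀ a b c k p q r →
      a * (p * q) + b * (p * r) + c * (q * r) + k * (p * q * r) ≡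
      a * (p * q) + (1ℤ + b) * (p * r) + c * (q * r) + k * (p * q * r) - p * r
    lemma = solve-∀

  value-↓γ : ∀ d → value (↓γ d) ≡ value d - + (q ℕ.* r)
  value-↓γ ⟨ a , b , zero  , k ⟩ =
    ≡.trans (cong (λ c → + a * (+ p * + q) + + b * (+ p * + r) + c * (+ q * + r) + (k - 1ℤ) * (+ p * + q * + r)) (+pred p))
      (≡.trans (lemma (+ a) (+ b) k (+ p) (+ q) (+ r)) (cong (λ z → value ⟨ a , b , 0 , k ⟩ - z) (≡.sym (ℤ.pos-* q r))))
    where
    lemma : ∀ a b k p q r →
      a * (p * q) + b * (p * r) + (p - 1ℤ) * (q * r) + (k - 1ℤ) * (p * q * r) ≡
      a * (p * q) + b * (p * r) + 0ℤ * (q * r) + k * (p * q * r) - q * r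
    lemma = solve-∀
  value-↓γ ⟨ a , b , suc c , k ⟩ =
    ≡.trans (lemma (+ a) (+ b) (+ c) k (+ p) (+ q) (+ r)) (cong (λ z → value ⟨ a , b , suc c , k ⟩ - z) (≡.sym (ℤ.pos-* q r)))
    where
    lemma : ∀ a b c k p q r →
      a * (p * q) + b * (p * r) + c * (q * r) + k * (p * q * r) ≡
      a * (p * q) + b * (p * r) + (1ℤ + c) * (q * r) + k * (p * q * r) - q * r
    lemma = solve-∀

  value-↓κ : ∀ d → value (↓κ d) ≡ value d - + (p ℕ.* q ℕ.* r)
  value-↓κ ⟨ a , b , c , k ⟩ =
    ≡.trans (lemma (+ a) (+ b) (+ c) k (+ p) (+ q) (+ r))
      (cong (λ z → value ⟨ a , b , c , k ⟩ - z) (≡.sym (≡.trans (ℤ.pos-* (p ℕ.* q) r) (cong (_* + r) (ℤ.pos-* p q)))))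
    where
    lemma : ∀ a b c k p q r →
      a * (p * q) + b * (p * r) + c * (q * r) + (k - 1ℤ) * (p * q * r) ≡
      a * (p * q) + b * (p * r) + c * (q * r) + k * (p * q * r) - p * q * r
    lemma = solve-∀

  -- The operator `T` in digit coordinates, written with `-1ℤ *` so that the two agree by
  -- computation.
  ∇ : (Digits → Digits) → (Digits → ℤ) → Digits → ℤ
  ∇ ↓ F d = F (↓ d) + -1ℤ * F d

  T-∇ : ∀ (↓ : Digits → Digits) m → (∀ d → Valid d → Valid (↓ d)) → (∀ d → value (↓ d) ≡ value d - + m) →
        ∀ F → T m (F ∘ digits) ≋ ∇ ↓ F ∘ digits
  T-∇ ↓ m valid eq F n = cong (λ d → F d + -1ℤ * F (digits n))
    (digits-unique (valid _ (digits-valid n)) (≡.trans (eq _) (cong (_- + m) (value-digits n))))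

  atOrigin : Digits → ℤ
  atOrigin ⟨ zero , zero , zero , + zero ⟩ = 1ℤ
  atOrigin _ = 0ℤ

  origin : Digits
  origin = ⟨ 0 , 0 , 0 , 0ℤ ⟩

  atOrigin-≢ : ∀ d → d ≢ origin → atOrigin d ≡ 0ℤ
  atOrigin-≢ ⟨ zero , zero , zero , + zero ⟩ d≢ = contradiction ≡.refl d≢
  atOrigin-≢ ⟨ zero , zero , zero , + suc _ ⟩ _ = ≡.refl
  atOrigin-≢ ⟨ zero , zero , zero , -[1+ _ ] ⟩ _ = ≡.refl
  atOrigin-≢ ⟨ zero , zero , suc _ , _ ⟩ _ = ≡.refl
  atOrigin-≢ ⟨ zero , suc _ , _ , _ ⟩ _ = ≡.refl
  atOrigin-≢ ⟨ suc _ , _ , _ , _ ⟩ _ = ≡.refl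

  value-origin : value origin ≡ 0ℤ
  value-origin = lemma (+ p) (+ q) (+ r)
    where
    lemma : ∀ p q r → 0ℤ * (p * q) + 0ℤ * (p * r) + 0ℤ * (q * r) + 0ℤ * (p * q * r) ≡ 0ℤ
    lemma = solve-∀

  atOrigin-digits : atOrigin ∘ digits ≋ δ
  atOrigin-digits (+ zero) =
    cong atOrigin (digits-unique {origin} (ℕ.>-nonZero⁻¹ r , ℕ.>-nonZero⁻¹ q , ℕ.>-nonZero⁻¹ p) value-origin)
  atOrigin-digits n@(+ suc _) = atOrigin-≢ (digits n) λ eq →
    case-absurd (≡.trans (≡.sym (value-digits n)) (≡.trans (cong value eq) value-origin))
    where
    case-absurd : ∀ {k} → + suc k ≢ 0ℤ
    case-absurd ()
  atOrigin-digits n@(-[1+ _ ]) = atOrigin-≢ (digits n) λ eq →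
    case-absurd (≡.trans (≡.sym (value-digits n)) (≡.trans (cong value eq) value-origin))
    where
    case-absurd : ∀ {k} → -[1+ k ] ≢ 0ℤ
    case-absurd ()

  x-x : ∀ x → x + -1ℤ * x ≡ 0ℤ
  x-x = solve-∀

  -- Lowering a positive digit leaves κ alone, so the difference along that digit is zero. If all
  -- digits are zero, each operator lowers κ by one, and the third difference of `suc⁺` remains:
  -- `suc⁺` has generating function 1/(1 - x)², and (x - 1)³ times it is x - 1. The remaining splits
  -- on digits only let the operators compute.
  ∇∇∇suc⁺ : ∀ d → ∇ ↓α (∇ ↓β (∇ ↓γ (suc⁺ ∘ κ))) d ≡ ∇ ↓κ atOrigin d
  ∇∇∇suc⁺ ⟨ suc a , zero  , zero  , k ⟩ =
    x-x (∇ ↓β (∇ ↓γ (suc⁺ ∘ κ)) ⟨ a , zero , zero , k ⟩)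
  ∇∇∇suc⁺ ⟨ suc a , zero  , suc c , k ⟩ =
    x-x (∇ ↓β (∇ ↓γ (suc⁺ ∘ κ)) ⟨ a , zero , suc c , k ⟩)
  ∇∇∇suc⁺ ⟨ suc a , suc b , zero  , k ⟩ =
    x-x (∇ ↓β (∇ ↓γ (suc⁺ ∘ κ)) ⟨ a , suc b , zero , k ⟩)
  ∇∇∇suc⁺ ⟨ suc a , suc b , suc c , k ⟩ =
    x-x (∇ ↓β (∇ ↓γ (suc⁺ ∘ κ)) ⟨ a , suc b , suc c , k ⟩)
  ∇∇∇suc⁺ ⟨ zero  , suc b , zero  , k ⟩ =
    lemma (suc⁺ (k - 1ℤ - 1ℤ)) (suc⁺ (k - 1ℤ)) (suc⁺ k)
    where
    lemma : ∀ x y z →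
      x + -1ℤ * y + -1ℤ * (x + -1ℤ * y) + -1ℤ * (y + -1ℤ * z + -1ℤ * (y + -1ℤ * z)) ≡ 0ℤ
    lemma = solve-∀
  ∇∇∇suc⁺ ⟨ zero  , suc b , suc c , k ⟩ = lemma (suc⁺ (k - 1ℤ)) (suc⁺ k)
    where
    lemma : ∀ x y →
      x + -1ℤ * x + -1ℤ * (x + -1ℤ * x) + -1ℤ * (y + -1ℤ * y + -1ℤ * (y + -1ℤ * y)) ≡ 0ℤ
    lemma = solve-∀
  ∇∇∇suc⁺ ⟨ zero  , zero  , suc c , k ⟩ =
    lemma (suc⁺ (k - 1ℤ - 1ℤ)) (suc⁺ (k - 1ℤ)) (suc⁺ k)
    where
    lemma : ∀ x y z →
      x + -1ℤ * x + -1ℤ * (y + -1ℤ * y) + -1ℤ * (y + -1ℤ * y + -1ℤ * (z + -1ℤ * z)) ≡ 0ℤ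
    lemma = solve-∀
  ∇∇∇suc⁺ ⟨ zero  , zero  , zero  , + 0 ⟩ = ≡.refl
  ∇∇∇suc⁺ ⟨ zero  , zero  , zero  , + 1 ⟩ = ≡.refl
  ∇∇∇suc⁺ ⟨ zero  , zero  , zero  , + 2 ⟩ = ≡.refl
  -- From κ = 3 on, all four arguments κ, ..., κ - 3 are non-negative, where `suc⁺` is linear.
  ∇∇∇suc⁺ ⟨ zero  , zero  , zero  , + suc (suc (suc k)) ⟩ = lemma (+ k)
    where
    lemma : ∀ k → (1ℤ + k + -1ℤ * (1ℤ + (1ℤ + k)) + -1ℤ * (1ℤ + (1ℤ + k) + -1ℤ * (1ℤ + (1ℤ + (1ℤ + k)))))
      + -1ℤ * (1ℤ + (1ℤ + k) + -1ℤ * (1ℤ + (1ℤ + (1ℤ + k)))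
        + -1ℤ * (1ℤ + (1ℤ + (1ℤ + k)) + -1ℤ * (1ℤ + (1ℤ + (1ℤ + (1ℤ + k)))))) ≡ 0ℤ
    lemma = solve-∀
  ∇∇∇suc⁺ ⟨ zero  , zero  , zero  , -[1+ k ] ⟩ = ≡.refl

  T-pq-pr-qr-M : T (p ℕ.* q) (T (p ℕ.* r) (T (q ℕ.* r) M)) ≋ T (p ℕ.* q ℕ.* r) δ
  T-pq-pr-qr-M n = begin
    T (p ℕ.* q) (T (p ℕ.* r) (T (q ℕ.* r) M)) n
      ≡⟨ T-cong (p ℕ.* q) (T-cong (p ℕ.* r) (T-∇ ↓γ (q ℕ.* r) ↓γ-valid value-↓γ (suc⁺ ∘ κ))) n ⟩
    T (p ℕ.* q) (T (p ℕ.* r) (∇ ↓γ (suc⁺ ∘ κ) ∘ digits)) n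
      ≡⟨ T-cong (p ℕ.* q) (T-∇ ↓β (p ℕ.* r) ↓β-valid value-↓β (∇ ↓γ (suc⁺ ∘ κ))) n ⟩
    T (p ℕ.* q) (∇ ↓β (∇ ↓γ (suc⁺ ∘ κ)) ∘ digits) n
      ≡⟨ T-∇ ↓α (p ℕ.* q) ↓α-valid value-↓α (∇ ↓β (∇ ↓γ (suc⁺ ∘ κ))) n ⟩
    ∇ ↓α (∇ ↓β (∇ ↓γ (suc⁺ ∘ κ))) (digits n)
      ≡⟨ ∇∇∇suc⁺ (digits n) ⟩
    ∇ ↓κ atOrigin (digits n)
      ≡⟨ T-∇ ↓κ (p ℕ.* q ℕ.* r) (λ _ v → v) value-↓κ atOrigin n ⟨
    T (p ℕ.* q ℕ.* r) (atOrigin ∘ digits) n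
      ≡⟨ T-cong (p ℕ.* q ℕ.* r) atOrigin-digits n ⟩
    T (p ℕ.* q ℕ.* r) δ n ∎

-- The bound on the jumps

atLeast0 atLeast-1 : ℤ → Bool
atLeast0 (+ _)    = true
atLeast0 -[1+ _ ] = false
atLeast-1 (+ _)           = true
atLeast-1 -[1+ zero ]     = true
atLeast-1 -[1+ suc _ ]    = false

-- The value of M (n - p) - M n; the two arguments of type `Bool` are the borrows at α and at β, and
-- the last argument is κ.
step : Bool → Bool → ℤ → ℤ
step true  true  k = ℤ.- bit (atLeast0 k)
step true  false k = 0ℤ
step false true  k = 0ℤ
step false false k = bit (atLeast-1 k)

suc⁺-step : ∀ a b k →
  suc⁺ (k ℤ.+ 1ℤ ℤ.- bit a ℤ.- bit b) ℤ.+ -1ℤ ℤ.* suc⁺ k ≡ step a b k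
suc⁺-step a b k =
  ≡.trans (cong (λ i → suc⁺ i ℤ.+ -1ℤ ℤ.* suc⁺ k) (reassoc k (bit a) (bit b))) (cases a b k)
  where
  -- With the closed summand 1, 0 or -1 in front, the sum reduces by matching on k.
  reassoc : ∀ k x y → k ℤ.+ 1ℤ ℤ.- x ℤ.- y ≡ (1ℤ ℤ.- x ℤ.- y) ℤ.+ k
  reassoc = solve-∀
  x-x : ∀ x → x ℤ.+ -1ℤ ℤ.* x ≡ 0ℤ
  x-x = solve-∀
  fall : ∀ x → 1ℤ ℤ.+ x ℤ.+ -1ℤ ℤ.* (1ℤ ℤ.+ (1ℤ ℤ.+ x)) ≡ -1ℤ
  fall = solve-∀
  rise : ∀ x → 1ℤ ℤ.+ (1ℤ ℤ.+ x) ℤ.+ -1ℤ ℤ.* (1ℤ ℤ.+ x) ≡ 1ℤ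
  rise = solve-∀
  unchanged : ∀ k → suc⁺ (0ℤ ℤ.+ k) ℤ.+ -1ℤ ℤ.* suc⁺ k ≡ 0ℤ
  unchanged k = ≡.trans (cong (λ i → suc⁺ i ℤ.+ -1ℤ ℤ.* suc⁺ k) (ℤ.+-identityˡ k)) (x-x (suc⁺ k))
  cases : ∀ a b k →
    suc⁺ ((1ℤ ℤ.- bit a ℤ.- bit b) ℤ.+ k) ℤ.+ -1ℤ ℤ.* suc⁺ k ≡ step a b k
  cases true  false k            = unchanged k
  cases false true  k            = unchanged k
  cases true  true  (+ zero)     = ≡.refl
  cases true  true  (+ suc k)    = fall (+ k)
  cases true  true  -[1+ k ]     = ≡.refl
  cases false false (+ k)        = rise (+ k)
  cases false false -[1+ zero ]  = ≡.refl
  cases false false -[1+ suc k ] = ≡.refl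

-- The unfolding of `T q (T r e) n`, with `e₀`, `e₁`, `e₂`, `e₃` the values at n, n - q, n - r, n -
-- q - r. The diagonals are 0, 3 with sign plus and 1, 2 with sign minus.
mixed : ℤ → ℤ → ℤ → ℤ → ℤ
mixed e₀ e₁ e₂ e₃ = (e₃ ℤ.+ -1ℤ ℤ.* e₁) ℤ.+ -1ℤ ℤ.* (e₂ ℤ.+ -1ℤ ℤ.* e₀)

-- For a concrete `f` the four `True` arguments evaluate to the unit type and are filled in
-- automatically.
check₂ : (f : Bool → Bool → ℤ)
  {_ : True (∣ f true true ∣ ℕ.≤? 1)} {_ : True (∣ f true false ∣ ℕ.≤? 1)}
  {_ : True (∣ f false true ∣ ℕ.≤? 1)} {_ : True (∣ f false false ∣ ℕ.≤? 1)} →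
  ∀ x y → ∣ f x y ∣ ≤ 1
check₂ f {w} {_} {_} {_} true  true  = toWitness w
check₂ f {_} {w} {_} {_} true  false = toWitness w
check₂ f {_} {_} {w} {_} false true  = toWitness w
check₂ f {_} {_} {_} {w} false false = toWitness w

NonCrossing : (ℤ → Bool) → ℤ → ℤ → ℤ → ℤ → Set
NonCrossing φ k₀ k₁ k₂ k₃ = φ k₀ ≡ true → φ k₃ ≡ true → φ k₁ ≡ false → φ k₂ ≡ false → ⊥

-- Of the sixteen patterns only two give absolute value 2: both ends of one diagonal set and both
-- ends of the other unset. These are what the hypotheses exclude.
mixed-bits : ∀ φ k₀ k₁ k₂ k₃ → NonCrossing φ k₀ k₁ k₂ k₃ → NonCrossing φ k₁ k₀ k₃ k₂ →
             ∣ mixed (bit (φ k₀)) (bit (φ k₁)) (bit (φ k₂)) (bit (φ k₃)) ∣ ≤ 1 ×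
             ∣ mixed (ℤ.- bit (φ k₀)) (ℤ.- bit (φ k₁)) (ℤ.- bit (φ k₂)) (ℤ.- bit (φ k₃)) ∣ ≤ 1
mixed-bits φ k₀ k₁ k₂ k₃ h h′ with φ k₀ | φ k₁ | φ k₂ | φ k₃
... | true  | false | false | true  = ⊥-elim (h ≡.refl ≡.refl ≡.refl ≡.refl)
... | false | true  | true  | false = ⊥-elim (h′ ≡.refl ≡.refl ≡.refl ≡.refl)
... | true  | true  | true  | true  = z≤n , z≤n
... | true  | true  | true  | false = s≤s z≤n , s≤s z≤n
... | true  | true  | false | true  = s≤s z≤n , s≤s z≤n
... | true  | true  | false | false = z≤n , z≤n
... | true  | false | true  | true  = s≤s z≤n , s≤s z≤n
... | true  | false | true  | false = z≤n , z≤n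
... | true  | false | false | false = s≤s z≤n , s≤s z≤n
... | false | true  | true  | true  = s≤s z≤n , s≤s z≤n
... | false | true  | false | true  = z≤n , z≤n
... | false | true  | false | false = s≤s z≤n , s≤s z≤n
... | false | false | true  | true  = z≤n , z≤n
... | false | false | true  | false = s≤s z≤n , s≤s z≤n
... | false | false | false | true  = s≤s z≤n , s≤s z≤n
... | false | false | false | false = z≤n , z≤n

-- Four corners of the same kind reduce to `mixed-bits`, with threshold s = 0 for two borrows and s
-- = -1 for none. Otherwise at most two corners contribute: neighbours of the same kind, which
-- `mixed` subtracts, or opposite corners of different kinds, whose values have opposite signs.
-- Either way a difference of two bits remains.
mixed-step : ∀ a a′ b b′ k₀ k₁ k₂ k₃ →
  (∀ s → (s ℤ.≤ k₀ → s ℤ.≤ k₃ → k₁ ℤ.< s → k₂ ℤ.< s → ⊥)) →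
  (∀ s → (s ℤ.≤ k₁ → s ℤ.≤ k₂ → k₀ ℤ.< s → k₃ ℤ.< s → ⊥)) →
  ∣ mixed (step a b k₀) (step a′ b k₁) (step a b′ k₂) (step a′ b′ k₃) ∣ ≤ 1
mixed-step a a′ b b′ k₀ k₁ k₂ k₃ h h′ = cases a a′ b b′
  where
  true⇒0≤ : ∀ k → atLeast0 k ≡ true → 0ℤ ℤ.≤ k
  true⇒0≤ (+ _) _ = ℤ.+≤+ z≤n
  false⇒<0 : ∀ k → atLeast0 k ≡ false → k ℤ.< 0ℤ
  false⇒<0 -[1+ _ ] _ = ℤ.-<+
  true⇒-1≤ : ∀ k → atLeast-1 k ≡ true → -1ℤ ℤ.≤ k
  true⇒-1≤ (+ _)       _ = ℤ.-≤+
  true⇒-1≤ -[1+ zero ] _ = ℤ.-≤- z≤n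
  false⇒<-1 : ∀ k → atLeast-1 k ≡ false → k ℤ.< -1ℤ
  false⇒<-1 -[1+ suc _ ] _ = ℤ.-<- (s≤s z≤n)
  cases : ∀ a a′ b b′ → ∣ mixed (step a b k₀) (step a′ b k₁) (step a b′ k₂) (step a′ b′ k₃) ∣ ≤ 1
  cases true  true  true  true  = proj₂ (mixed-bits atLeast0 k₀ k₁ k₂ k₃
    (λ x y z w → h 0ℤ (true⇒0≤ k₀ x) (true⇒0≤ k₃ y) (false⇒<0 k₁ z) (false⇒<0 k₂ w))
    (λ x y z w → h′ 0ℤ (true⇒0≤ k₁ x) (true⇒0≤ k₂ y) (false⇒<0 k₀ z) (false⇒<0 k₃ w)))
  cases false false false false = proj₁ (mixed-bits atLeast-1 k₀ k₁ k₂ k₃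
    (λ x y z w → h -1ℤ (true⇒-1≤ k₀ x) (true⇒-1≤ k₃ y) (false⇒<-1 k₁ z) (false⇒<-1 k₂ w))
    (λ x y z w → h′ -1ℤ (true⇒-1≤ k₁ x) (true⇒-1≤ k₂ y) (false⇒<-1 k₀ z) (false⇒<-1 k₃ w)))
  cases true  true  true  false = check₂ (λ x y → mixed (ℤ.- bit x) (ℤ.- bit y) 0ℤ 0ℤ) (atLeast0 k₀) (atLeast0 k₁)
  cases true  true  false true  = check₂ (λ x y → mixed 0ℤ 0ℤ (ℤ.- bit x) (ℤ.- bit y)) (atLeast0 k₂) (atLeast0 k₃)
  cases true  true  false false = z≤n
  cases true  false true  true  = check₂ (λ x y → mixed (ℤ.- bit x) 0ℤ (ℤ.- bit y) 0ℤ) (atLeast0 k₀) (atLeast0 k₂)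
  cases true  false true  false = check₂ (λ x y → mixed (ℤ.- bit x) 0ℤ 0ℤ (bit y)) (atLeast0 k₀) (atLeast-1 k₃)
  cases true  false false true  = check₂ (λ x y → mixed 0ℤ (bit x) (ℤ.- bit y) 0ℤ) (atLeast-1 k₁) (atLeast0 k₂)
  cases true  false false false = check₂ (λ x y → mixed 0ℤ (bit x) 0ℤ (bit y)) (atLeast-1 k₁) (atLeast-1 k₃)
  cases false true  true  true  = check₂ (λ x y → mixed 0ℤ (ℤ.- bit x) 0ℤ (ℤ.- bit y)) (atLeast0 k₁) (atLeast0 k₃)
  cases false true  true  false = check₂ (λ x y → mixed 0ℤ (ℤ.- bit x) (bit y) 0ℤ) (atLeast0 k₁) (atLeast-1 k₂)
  cases false true  false true  = check₂ (λ x y → mixed (bit x) 0ℤ 0ℤ (ℤ.- bit y)) (atLeast-1 k₀) (atLeast0 k₃)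
  cases false true  false false = check₂ (λ x y → mixed (bit x) 0ℤ (bit y) 0ℤ) (atLeast-1 k₀) (atLeast-1 k₂)
  cases false false true  true  = z≤n
  cases false false true  false = check₂ (λ x y → mixed 0ℤ 0ℤ (bit x) (bit y)) (atLeast-1 k₂) (atLeast-1 k₃)
  cases false false false true  = check₂ (λ x y → mixed (bit x) (bit y) 0ℤ 0ℤ) (atLeast-1 k₀) (atLeast-1 k₁)

-- For 0 ≤ c < p, c + pk is at least ps if k ≥ s and below ps if k < s. One diagonal would sum to at
-- least 2ps and the other to less.
no-crossing : ∀ p {c₀ c₁ c₂ c₃} (k₀ k₁ k₂ k₃ : ℤ) → c₁ < p → c₂ < p →
  (+ c₀ ℤ.+ + p ℤ.* k₀) ℤ.+ (+ c₃ ℤ.+ + p ℤ.* k₃) ≡ (+ c₁ ℤ.+ + p ℤ.* k₁) ℤ.+ (+ c₂ ℤ.+ + p ℤ.* k₂) →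
  ∀ s → s ℤ.≤ k₀ → s ℤ.≤ k₃ → k₁ ℤ.< s → k₂ ℤ.< s → ⊥
no-crossing p k₀ k₁ k₂ k₃ c₁<p c₂<p eq s s≤k₀ s≤k₃ k₁<s k₂<s =
  ℤ.<-irrefl ≡.refl (ℤ.≤-<-trans (ℤ.+-mono-≤ (lower s≤k₀) (lower s≤k₃))
    (subst (ℤ._< + p ℤ.* s ℤ.+ + p ℤ.* s) (≡.sym eq) (ℤ.+-mono-< (upper c₁<p k₁<s) (upper c₂<p k₂<s))))
  where
  lower : ∀ {c k} → s ℤ.≤ k → + p ℤ.* s ℤ.≤ + c ℤ.+ + p ℤ.* k
  lower {c} {k} s≤k = ℤ.≤-trans (ℤ.*-monoˡ-≤-nonNeg (+ p) s≤k) (ℤ.i≤j+i (+ p ℤ.* k) (+ c))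
  upper : ∀ {c k} → c < p → k ℤ.< s → + c ℤ.+ + p ℤ.* k ℤ.< + p ℤ.* s
  upper {c} {k} c<p k<s = ℤ.<-≤-trans (ℤ.+-monoˡ-< (+ p ℤ.* k) (ℤ.+<+ c<p))
    (subst (ℤ._≤ + p ℤ.* s) (lemma (+ p) k) (ℤ.*-monoˡ-≤-nonNeg (+ p) (ℤ.i<j⇒suc[i]≤j k<s)))
    where
    lemma : ∀ p k → p ℤ.* (1ℤ ℤ.+ k) ≡ p ℤ.+ p ℤ.* k
    lemma = solve-∀

-- Digits of p and the jumps of the coefficients.

module Jumps (p q r : ℕ) (1<q : 1 < q) (1<r : 1 < r)
  {{_ : NonZero p}} {{_ : NonZero q}} {{_ : NonZero r}}
  (p⊥q : Coprime p q) (p⊥r : Coprime p r) (q⊥r : Coprime q r) where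

  open import Data.Integer.Base using (_+_; _*_; _-_; -_)
  open ≡-Reasoning
  open Coordinates p q r p⊥q p⊥r q⊥r
  open Digits
  open ℤSeq

  μ ν : ℕ
  μ  = α (digits (+ p))
  ν = β (digits (+ p))

  -- γ is 0 because p divides p. Dividing the value by p leaves μq + νr + κqr = 1. For κ ≥ 0 the
  -- left side is 0 or at least one of q, r, which exceed 1; for κ ≤ -2 it would force μq + νr >
  -- 2qr, against μ < r and ν < q.
  digits-p : digits (+ p) ≡ ⟨ μ , ν , 0 , -1ℤ ⟩
  digits-p = shape (digits (+ p)) (γ-cong {digits (+ p)} {origin} (digits-valid (+ p)) origin-valid 1ℤ
      (≡.trans (cong₂ _-_ (value-digits (+ p)) value-origin) (≡.trans (ℤ.+-identityʳ (+ p)) (≡.sym (ℤ.*-identityˡ (+ p))))))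
    (digits-valid (+ p)) (value-digits (+ p))
    where
    origin-valid : Valid origin
    origin-valid = ℕ.>-nonZero⁻¹ r , ℕ.>-nonZero⁻¹ q , ℕ.>-nonZero⁻¹ p
    factor : ∀ a b k p q r → a * (p * q) + b * (p * r) + 0ℤ * (q * r) + k * (p * q * r) ≡ (a * q + b * r + k * (q * r)) * p
    factor = solve-∀
    reduce : ∀ a b k → value ⟨ a , b , 0 , k ⟩ ≡ + p → + a * + q + + b * + r + k * (+ q * + r) ≡ 1ℤ
    reduce a b k eq = ℤ.*-cancelʳ-≡ _ 1ℤ (+ p)
      (≡.trans (≡.sym (factor (+ a) (+ b) k (+ p) (+ q) (+ r))) (≡.trans eq (≡.sym (ℤ.*-identityˡ (+ p)))))
    nat : ∀ a b k → + a * + q + + b * + r + + k * (+ q * + r) ≡ + (a ℕ.* q ℕ.+ b ℕ.* r ℕ.+ k ℕ.* (q ℕ.* r))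
    nat a b k = ≡.sym (cong₂ _+_ (cong₂ _+_ (ℤ.pos-* a q) (ℤ.pos-* b r))
      (≡.trans (ℤ.pos-* k (q ℕ.* r)) (cong (+ k *_) (ℤ.pos-* q r))))
    not-one : ∀ a b k → a ℕ.* q ℕ.+ b ℕ.* r ℕ.+ k ℕ.* (q ℕ.* r) ≢ 1
    not-one (suc a) b k eq =
      ℕ.<⇒≢ (ℕ.≤-trans 1<q (ℕ.≤-trans (ℕ.m≤m+n q _) (ℕ.≤-trans (ℕ.m≤m+n _ (b ℕ.* r)) (ℕ.m≤m+n _ _)))) (≡.sym eq)
    not-one zero (suc b) k eq =
      ℕ.<⇒≢ (ℕ.≤-trans 1<r (ℕ.≤-trans (ℕ.m≤m+n r _) (ℕ.m≤m+n _ _))) (≡.sym eq)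
    not-one zero zero (suc k) eq =
      ℕ.<⇒≢ (ℕ.≤-trans 1<q (ℕ.≤-trans (ℕ.m≤m*n q r) (ℕ.m≤m+n _ _))) (≡.sym eq)
    too-negative : ∀ a b k → a < r → b < q → + a * + q + + b * + r + -[1+ suc k ] * (+ q * + r) ≢ 1ℤ
    too-negative a b k a<r b<q eq = ℕ.<⇒≱ (s≤s (ℕ.+-monoʳ-≤ (q ℕ.* r) (ℕ.m≤m+n (q ℕ.* r) (k ℕ.* (q ℕ.* r)))))
      (subst (_≤ q ℕ.* r ℕ.+ q ℕ.* r) (ℤ.+-injective sum) (ℕ.+-mono-≤ aq≤ br≤))
      where
      aq≤ : a ℕ.* q ≤ q ℕ.* r
      aq≤ = subst (a ℕ.* q ≤_) (ℕ.*-comm r q) (ℕ.*-monoˡ-≤ q (ℕ.<⇒≤ a<r))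
      br≤ : b ℕ.* r ≤ q ℕ.* r
      br≤ = ℕ.*-monoˡ-≤ r (ℕ.<⇒≤ b<q)
      move : ∀ a b k q r → a * q + b * r ≡ (a * q + b * r + - k * (q * r)) + k * (q * r)
      move = solve-∀
      sum : + (a ℕ.* q ℕ.+ b ℕ.* r) ≡ + suc (suc (suc k) ℕ.* (q ℕ.* r))
      sum = begin
        + (a ℕ.* q ℕ.+ b ℕ.* r)         ≡⟨ cong₂ _+_ (ℤ.pos-* a q) (ℤ.pos-* b r) ⟩
        + a * + q + + b * + r           ≡⟨ move (+ a) (+ b) (+ suc (suc k)) (+ q) (+ r) ⟩
        (+ a * + q + + b * + r + -[1+ suc k ] * (+ q * + r)) + + suc (suc k) * (+ q * + r)
          ≡⟨ cong₂ _+_ eq (≡.trans (cong (+ suc (suc k) *_) (≡.sym (ℤ.pos-* q r))) (≡.sym (ℤ.pos-* (suc (suc k)) (q ℕ.* r)))) ⟩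
        + suc (suc (suc k) ℕ.* (q ℕ.* r)) ∎
    shape : ∀ d → γ d ≡ 0 → Valid d → value d ≡ + p → d ≡ ⟨ α d , β d , 0 , -1ℤ ⟩
    shape ⟨ a , b , _ , -[1+ zero ] ⟩ ≡.refl _ _ = ≡.refl
    shape ⟨ a , b , _ , + k ⟩ ≡.refl _ eq =
      ⊥-elim (not-one a b k (ℤ.+-injective (≡.trans (≡.sym (nat a b k)) (reduce a b (+ k) eq))))
    shape ⟨ a , b , _ , -[1+ suc k ] ⟩ ≡.refl (a< , b< , _) eq =
      ⊥-elim (too-negative a b k a< b< (reduce a b -[1+ suc k ] eq))

  lowα lowβ : ℤ → Bool
  lowα n = α (digits n) ℕ.<ᵇ μ
  lowβ n = β (digits n) ℕ.<ᵇ ν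

  value-p : + p ≡ value ⟨ μ , ν , 0 , -1ℤ ⟩
  value-p = ≡.trans (≡.sym (value-digits (+ p))) (cong value digits-p)

  -- Digitwise subtraction of (μ, ν, 0, -1): the last entry raises κ by one, each borrow at α or β
  -- lowers it by one, and γ never borrows.
  κ-shift : ∀ n → κ (digits (n - + p)) ≡ κ (digits n) + 1ℤ - bit (lowα n) - bit (lowβ n)
  κ-shift n with borrow (proj₁ (digits-valid n)) (proj₁ (digits-valid (+ p)))
               | borrow (proj₁ (proj₂ (digits-valid n))) (proj₁ (proj₂ (digits-valid (+ p))))
  ... | a , a<r , eqa | b , b<q , eqb = cong κ (digits-unique
    {⟨ a , b , γ (digits n) , κ (digits n) + 1ℤ - bit (lowα n) - bit (lowβ n) ⟩}
    (a<r , b<q , proj₂ (proj₂ (digits-valid n))) (begin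
      + a * (+ p * + q) + + b * (+ p * + r) + + γ (digits n) * (+ q * + r)
        + (κ (digits n) + 1ℤ - bit (lowα n) - bit (lowβ n)) * (+ p * + q * + r)
        ≡⟨ regroup (+ a) (+ b) (+ γ (digits n)) (κ (digits n)) (bit (lowα n)) (bit (lowβ n)) (+ p) (+ q) (+ r) ⟩
      (+ a - bit (lowα n) * + r) * (+ p * + q) + (+ b - bit (lowβ n) * + q) * (+ p * + r)
        + + γ (digits n) * (+ q * + r) + (κ (digits n) + 1ℤ) * (+ p * + q * + r)
        ≡⟨ cong₂ (λ x y → x * (+ p * + q) + y * (+ p * + r)
             + + γ (digits n) * (+ q * + r) + (κ (digits n) + 1ℤ) * (+ p * + q * + r)) eqa eqb ⟨
      (+ α (digits n) - + μ) * (+ p * + q) + (+ β (digits n) - + ν) * (+ p * + r)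
        + + γ (digits n) * (+ q * + r) + (κ (digits n) + 1ℤ) * (+ p * + q * + r)
        ≡⟨ split (+ α (digits n)) (+ β (digits n)) (+ γ (digits n)) (κ (digits n)) (+ μ) (+ ν) (+ p) (+ q) (+ r) ⟩
      value (digits n) - value ⟨ μ , ν , 0 , -1ℤ ⟩
        ≡⟨ cong₂ _-_ (value-digits n) (≡.sym value-p) ⟩
      n - + p ∎))
    where
    regroup : ∀ a b c k x y p q r →
      a * (p * q) + b * (p * r) + c * (q * r) + (k + 1ℤ - x - y) * (p * q * r) ≡
      (a - x * r) * (p * q) + (b - y * q) * (p * r) + c * (q * r) + (k + 1ℤ) * (p * q * r)
    regroup = solve-∀
    split : ∀ a b c k m l p q r →
      (a - m) * (p * q) + (b - l) * (p * r) + c * (q * r) + (k + 1ℤ) * (p * q * r) ≡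
      a * (p * q) + b * (p * r) + c * (q * r) + k * (p * q * r)
      - (m * (p * q) + l * (p * r) + 0ℤ * (q * r) + -1ℤ * (p * q * r))
    split = solve-∀

  T-M : ∀ n → T p M n ≡ step (lowα n) (lowβ n) (κ (digits n))
  T-M n = ≡.trans (cong (λ k → suc⁺ k + -1ℤ * M n) (κ-shift n))
    (suc⁺-step (lowα n) (lowβ n) (κ (digits n)))

  α-shift : ∀ n → α (digits (n - + r)) ≡ α (digits n)
  α-shift n = ≡.sym (α-cong {digits n} {digits (n - + r)} (digits-valid n) (digits-valid (n - + r)) 1ℤ
    (≡.trans (cong₂ _-_ (value-digits n) (value-digits (n - + r))) (lemma n (+ r))))
    where
    lemma : ∀ n m → n - (n - m) ≡ 1ℤ * m
    lemma = solve-∀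

  β-shift : ∀ n → β (digits (n - + q)) ≡ β (digits n)
  β-shift n = ≡.sym (β-cong {digits n} {digits (n - + q)} (digits-valid n) (digits-valid (n - + q)) 1ℤ
    (≡.trans (cong₂ _-_ (value-digits n) (value-digits (n - + q))) (lemma n (+ q))))
    where
    lemma : ∀ n m → n - (n - m) ≡ 1ℤ * m
    lemma = solve-∀

  -- The α and β terms agree on both sides and cancel; what remains is qr times γ + pκ at each
  -- corner.
  γκ-parallelogram : ∀ {a a′ b b′ c₀ c₁ c₂ c₃ k₀ k₁ k₂ k₃} →
    value ⟨ a , b , c₀ , k₀ ⟩ + value ⟨ a′ , b′ , c₃ , k₃ ⟩ ≡ value ⟨ a′ , b , c₁ , k₁ ⟩ + value ⟨ a , b′ , c₂ , k₂ ⟩ →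
    (+ c₀ + + p * k₀) + (+ c₃ + + p * k₃) ≡ (+ c₁ + + p * k₁) + (+ c₂ + + p * k₂)
  γκ-parallelogram {a} {a′} {b} {b′} {c₀} {c₁} {c₂} {c₃} {k₀} {k₁} {k₂} {k₃} eq =
    ℤ.*-cancelʳ-≡ _ _ (+ q * + r) {{ℤ.i*j≢0 (+ q) (+ r)}} (ℤ-+-cancelˡ common _ _
      (≡.trans (lemma (+ a) (+ a′) (+ b) (+ b′) (+ c₀) (+ c₃) k₀ k₃ (+ p) (+ q) (+ r))
        (≡.trans eq (≡.sym (≡.trans (cong (_+ ((+ c₁ + + p * k₁) + (+ c₂ + + p * k₂)) * (+ q * + r)) common-swap)
          (lemma (+ a′) (+ a) (+ b) (+ b′) (+ c₁) (+ c₂) k₁ k₂ (+ p) (+ q) (+ r)))))))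
    where
    common = (+ a + + a′) * (+ p * + q) + (+ b + + b′) * (+ p * + r)
    common-swap : common ≡ (+ a′ + + a) * (+ p * + q) + (+ b + + b′) * (+ p * + r)
    common-swap = cong (λ x → x * (+ p * + q) + (+ b + + b′) * (+ p * + r)) (ℤ.+-comm (+ a) (+ a′))
    lemma : ∀ a a′ b b′ c c′ k k′ p q r →
      (a + a′) * (p * q) + (b + b′) * (p * r) + ((c + p * k) + (c′ + p * k′)) * (q * r) ≡
      (a * (p * q) + b * (p * r) + c * (q * r) + k * (p * q * r))
      + (a′ * (p * q) + b′ * (p * r) + c′ * (q * r) + k′ * (p * q * r))
    lemma = solve-∀

  jump-bound : ∀ n → ∣ T p (T q (T r M)) n ∣ ≤ 1
  jump-bound n = subst (λ z → ∣ z ∣ ≤ 1) (≡.sym (begin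
      T p (T q (T r M)) n
        -- `T p` moves innermost, where `T-M` evaluates it; the outer `T q` and `T r` form the mixed
        -- difference.
        ≡⟨ T-comm p q (T r M) n ⟩
      T q (T p (T r M)) n
        ≡⟨ T-cong q (T-comm p r M) n ⟩
      T q (T r (T p M)) n
        ≡⟨ T-cong q (T-cong r T-M) n ⟩
      mixed (e n) (e n₁) (e n₂) (e n₃)
        -- β is shared along the shift by q and α along the shift by r, so the four corners involve
        -- only two values of each borrow.
        ≡⟨ cong₂ (λ x y → mixed (e n) x y (e n₃)) (cong (λ b → step (lowα n₁) (b ℕ.<ᵇ ν) (κ (digits n₁))) (β-shift n))
             (cong (λ a → step (a ℕ.<ᵇ μ) (lowβ n₂) (κ (digits n₂))) (α-shift n)) ⟩
      mixed (e n) (step (lowα n₁) (lowβ n) (κ (digits n₁))) (step (lowα n) (lowβ n₂) (κ (digits n₂))) (e n₃)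
        ≡⟨ cong (mixed (e n) (step (lowα n₁) (lowβ n) (κ (digits n₁))) (step (lowα n) (lowβ n₂) (κ (digits n₂))))
             (cong₂ (λ a b → step (a ℕ.<ᵇ μ) (b ℕ.<ᵇ ν) (κ (digits n₃))) α₃ β₃) ⟩
      mixed (e n) (step (lowα n₁) (lowβ n) (κ (digits n₁))) (step (lowα n) (lowβ n₂) (κ (digits n₂)))
        (step (lowα n₁) (lowβ n₂) (κ (digits n₃))) ∎))
    (mixed-step (lowα n) (lowα n₁) (lowβ n) (lowβ n₂) (κ (digits n)) (κ (digits n₁)) (κ (digits n₂)) (κ (digits n₃))
      (no-crossing p (κ (digits n)) (κ (digits n₁)) (κ (digits n₂)) (κ (digits n₃)) (γ< n₁) (γ< n₂) parallelogram)
      (no-crossing p (κ (digits n₁)) (κ (digits n)) (κ (digits n₃)) (κ (digits n₂)) (γ< n) (γ< n₃) (≡.sym parallelogram)))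
    where
    n₁ n₂ n₃ : ℤ
    n₁ = n - + q
    n₂ = n - + r
    n₃ = n - + q - + r
    e : ℤ → ℤ
    e m = step (lowα m) (lowβ m) (κ (digits m))
    γ< : ∀ m → γ (digits m) < p
    γ< m = proj₂ (proj₂ (digits-valid m))
    α₃ : α (digits n₃) ≡ α (digits n₁)
    α₃ = α-shift n₁
    swap : ∀ n i j → n - i - j ≡ n - j - i
    swap = solve-∀
    β₃ : β (digits n₃) ≡ β (digits n₂)
    β₃ = ≡.trans (cong (β ∘ digits) (swap n (+ q) (+ r))) (β-shift n₂)
    values : value (digits n) + value (digits n₃) ≡ value (digits n₁) + value (digits n₂)
    values = ≡.trans (cong₂ _+_ (value-digits n) (value-digits n₃))
      (≡.trans (lemma n (+ q) (+ r)) (≡.sym (cong₂ _+_ (value-digits n₁) (value-digits n₂))))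
      where
      lemma : ∀ n i j → n + (n - i - j) ≡ (n - i) + (n - j)
      lemma = solve-∀
    withαβ : ∀ d {a b} → α d ≡ a → β d ≡ b → value d ≡ value ⟨ a , b , γ d , κ d ⟩
    withαβ d ≡.refl ≡.refl = ≡.refl
    parallelogram : (+ γ (digits n) + + p * κ (digits n)) + (+ γ (digits n₃) + + p * κ (digits n₃)) ≡
                    (+ γ (digits n₁) + + p * κ (digits n₁)) + (+ γ (digits n₂) + + p * κ (digits n₂))
    parallelogram = γκ-parallelogram {α (digits n)} {α (digits n₁)} {β (digits n)} {β (digits n₂)}
      (≡.trans (cong (λ z → value (digits n) + z) (≡.sym (withαβ (digits n₃) α₃ β₃)))
        (≡.trans values (cong₂ _+_ (withαβ (digits n₁) ≡.refl (β-shift n)) (withαβ (digits n₂) (α-shift n) ≡.refl))))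


-- The sign is that of the factor x - 1.
partialSums : ℤSeq.Seq → ℤSeq.Seq
partialSums b (+ zero)  = ℤ.- b 0ℤ
partialSums b (+ suc n) = partialSums b (+ n) ℤ.- b (+ suc n)
partialSums b -[1+ n ]  = 0ℤ

T-partialSums : ∀ {b} → ℤSeq.Causal b → ℤSeq.T 1 (partialSums b) ℤSeq.≋ b
T-partialSums {b} h (+ zero)  = lemma (b 0ℤ)
  where
  lemma : ∀ x → 0ℤ ℤ.+ -1ℤ ℤ.* ℤ.- x ≡ x
  lemma = solve-∀
T-partialSums {b} h (+ suc n) = lemma (partialSums b (+ n)) (b (+ suc n))
  where
  lemma : ∀ y x → y ℤ.+ -1ℤ ℤ.* (y ℤ.- x) ≡ x
  lemma = solve-∀
T-partialSums {b} h -[1+ n ]  = ≡.sym (h n)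

-- Inclusion–exclusion on the exponents

open import Data.Nat.Base using (_*_)

*-∣ : ∀ {m n k} → Coprime n m → m ∣ k → n ∣ k → m * n ∣ k
*-∣ {m} {n} n⊥m (divides j ≡.refl) n∣jm =
  ≡.subst (m * n ∣_) (ℕ.*-comm m j) (*-monoʳ-∣ m (coprime-divisor n⊥m (≡.subst (n ∣_) (ℕ.*-comm j m) n∣jm)))

prime∤⇒coprime : ∀ {p k} → Prime p → p ∤ k → Coprime k p
prime∤⇒coprime pr p∤k (d∣k , d∣p) with prime⇒irreducible pr d∣p
... | inj₁ d≡1    = d≡1
... | inj₂ ≡.refl = contradiction d∣k p∤k

prime∤prime : ∀ {p q} → Prime p → Prime q → p ≢ q → ¬ q ∣ p
prime∤prime pp pq p≢q q∣p with prime⇒irreducible pp q∣p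
... | inj₁ ≡.refl = ¬prime[1] pq
... | inj₂ q≡p    = p≢q (≡.sym q≡p)

prime∤1 : ∀ {p} → Prime p → ¬ p ∣ 1
prime∤1 pp p∣1 with ∣1⇒≡1 p∣1
... | ≡.refl = ¬prime[1] pp

-- Both lists are free of duplicates, so having the same members already makes them permutations of
-- each other.
multiples : ∀ d m → .{{_ : NonZero d}} → filter (d ∣?_) (upTo (d * m)) ↭ map (d *_) (upTo m)
multiples d m = ∼bag⇒↭ (unique∧set⇒bag (Unique.filter⁺ (d ∣?_) (Unique.upTo⁺ (d * m)))
  (Unique.map⁺ (λ {i} {j} → ℕ.*-cancelˡ-≡ i j d) (Unique.upTo⁺ m)) (mk⇔ to from))
  where
  to : ∀ {k} → k ∈ filter (d ∣?_) (upTo (d * m)) → k ∈ map (d *_) (upTo m)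
  to k∈ with ∈-filter⁻ (d ∣?_) {xs = upTo (d * m)} k∈
  ... | k∈upTo , divides j ≡.refl = ≡.subst (_∈ map (d *_) (upTo m)) (ℕ.*-comm d j)
    (∈-map⁺ (d *_) (∈-upTo⁺ (ℕ.*-cancelˡ-< d j m (≡.subst (_< d * m) (ℕ.*-comm j d) (∈-upTo⁻ k∈upTo)))))
  from : ∀ {k} → k ∈ map (d *_) (upTo m) → k ∈ filter (d ∣?_) (upTo (d * m))
  from k∈ with ∈-map⁻ (d *_) k∈
  ... | j , j∈ , ≡.refl = ∈-filter⁺ (d ∣?_) (∈-upTo⁺ (ℕ.*-monoʳ-< d (∈-upTo⁻ j∈))) (m∣m*n j)

indicator-cong : ∀ {a b} {A : Set a} {B : Set b} (a? : Dec A) (b? : Dec B) →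
  (A → B) → (B → A) → indicator a? ≡ indicator b?
indicator-cong (yes _) (yes _) _ _ = ≡.refl
indicator-cong (no _)  (no _)  _ _ = ≡.refl
indicator-cong (yes a) (no ¬b) f _ = contradiction (f a) ¬b
indicator-cong (no ¬a) (yes b) _ g = contradiction (g b) ¬a

indicator-× : ∀ {a b} {A : Set a} {B : Set b} (a? : Dec A) (b? : Dec B) →
  indicator (a? ×-dec b?) ≡ indicator a? * indicator b?
indicator-× (yes _) (yes _) = ≡.refl
indicator-× (yes _) (no _)  = ≡.refl
indicator-× (no _)  _       = ≡.refl

product-indicator : ∀ {m n} → Coprime n m → ∀ k → indicator (m * n ∣? k) ≡ indicator (m ∣? k) * indicator (n ∣? k)
product-indicator {m} {n} n⊥m k = ≡.trans
  (indicator-cong (m * n ∣? k) ((m ∣? k) ×-dec (n ∣? k))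
    (λ mn∣k → m*n∣⇒m∣ m n mn∣k , m*n∣⇒n∣ m n mn∣k) (λ (m∣k , n∣k) → *-∣ n⊥m m∣k n∣k))
  (indicator-× (m ∣? k) (n ∣? k))

totative? : ∀ N k → Dec (0 < k × gcd k N ≡ 1)
totative? N k = (0 ℕ.<? k) ×-dec (gcd k N ℕ.≟ 1)

module _ {p q r} (pp : Prime p) (pq : Prime q) (pr : Prime r)
  (p⊥q : Coprime p q) (p⊥r : Coprime p r) (q⊥r : Coprime q r) where

  -- A prime dividing k and pqr would divide their gcd; conversely, k prime to each factor is prime
  -- to the product. At k = 0 both indicators vanish, as p divides 0.
  totative-indicator : ∀ k →
    indicator (totative? (p * q * r) k) ≡ indicator (¬? (p ∣? k) ×-dec ¬? (q ∣? k) ×-dec ¬? (r ∣? k))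
  totative-indicator k = indicator-cong (totative? (p * q * r) k)
    (¬? (p ∣? k) ×-dec ¬? (q ∣? k) ×-dec ¬? (r ∣? k)) to (from k)
    where
    to : 0 < k × gcd k (p * q * r) ≡ 1 → p ∤ k × q ∤ k × r ∤ k
    to (_ , gcd≡1) =
        none pp (∣m⇒∣m*n r (m∣m*n q))
      , none pq (∣m⇒∣m*n r (n∣m*n p))
      , none pr (n∣m*n (p * q))
      where
      none : ∀ {s} → Prime s → s ∣ p * q * r → s ∤ k
      none {s} ps s∣N s∣k = prime∤1 ps (≡.subst (s ∣_) gcd≡1 (gcd-greatest s∣k s∣N))
    from : ∀ k → p ∤ k × q ∤ k × r ∤ k → 0 < k × gcd k (p * q * r) ≡ 1
    from zero    (p∤k , _)         = contradiction (p ∣0) p∤k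
    from k@(suc _) (p∤k , q∤k , r∤k) = s≤s z≤n ,
      coprime⇒gcd≡1 (coprime-*ˡ {k} {p * q} {r}
        (coprime-*ˡ {k} {p} {q} (prime∤⇒coprime pp p∤k) (prime∤⇒coprime pq q∤k)) (prime∤⇒coprime pr r∤k))

  -- Expansion of (1 - a)(1 - b)(1 - c) with the negative terms moved across, as exponents are
  -- natural numbers. The two sides are the multiplicities of the root ζᵏ in the two sides of the
  -- product identity for Φ: d ∣ k marks the roots of x^(pqr/d) - 1.
  inclusion–exclusion : ∀ k →
    indicator (totative? (p * q * r) k) ℕ.+
      (indicator (p ∣? k) ℕ.+ (indicator (q ∣? k) ℕ.+ (indicator (r ∣? k) ℕ.+ indicator (p * q * r ∣? k)))) ≡
    indicator (1 ∣? k) ℕ.+ (indicator (p * q ∣? k) ℕ.+ (indicator (p * r ∣? k) ℕ.+ indicator (q * r ∣? k)))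
  inclusion–exclusion k
    rewrite totative-indicator k
          | product-indicator {p * q} {r} (coprime-*ˡ {r} {p} {q} (Coprime.sym {p} {r} p⊥r) (Coprime.sym {q} {r} q⊥r)) k
          | product-indicator {p} {q} (Coprime.sym {p} {q} p⊥q) k
          | product-indicator {p} {r} (Coprime.sym {p} {r} p⊥r) k
          | product-indicator {q} {r} (Coprime.sym {q} {r} q⊥r) k
          | indicator-cong (1 ∣? k) (yes (1∣ k)) (λ x → x) (λ x → x)
    = count (p ∣? k) (q ∣? k) (r ∣? k)
    where
    count : ∀ {A B C : Set} (a? : Dec A) (b? : Dec B) (c? : Dec C) →
      indicator (¬? a? ×-dec ¬? b? ×-dec ¬? c?) ℕ.+
        (indicator a? ℕ.+ (indicator b? ℕ.+ (indicator c? ℕ.+ indicator a? * indicator b? * indicator c?))) ≡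
      1 ℕ.+ (indicator a? * indicator b? ℕ.+ (indicator a? * indicator c? ℕ.+ indicator b? * indicator c?))
    count (yes _) (yes _) (yes _) = ≡.refl
    count (yes _) (yes _) (no _)  = ≡.refl
    count (yes _) (no _)  (yes _) = ≡.refl
    count (yes _) (no _)  (no _)  = ≡.refl
    count (no _)  (yes _) (yes _) = ≡.refl
    count (no _)  (yes _) (no _)  = ≡.refl
    count (no _)  (no _)  (yes _) = ≡.refl
    count (no _)  (no _)  (no _)  = ≡.refl


-- The coefficients of Φ over the field as images of integers.

module Coefficients {c ℓ₁ ℓ₂} (K : HeytingField c ℓ₁ ℓ₂) where
  open Cyclotomic K
  open CommutativeRing commutativeRing
    using ( setoid; semiring; ring; +-monoid; 0#; 1#; refl; sym; trans; reflexive; +-congʳ; +-congˡ; +-assoc; +-comm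
          ; +-identityˡ; +-identityʳ; -‿cong; -‿inverseʳ; *-congˡ; *-congʳ; *-assoc; *-identityʳ )
    renaming (_+_ to _⊕_; _*_ to _⊗_; -_ to ⊝_; _-_ to _⊖_)
  open import Algebra.Properties.Ring ring using (-0#≈0#; -‿involutive; -‿+-comm; -1*x≈-x)
  open import Algebra.Properties.Semiring.Exp semiring using (_^_; ^-assocʳ)
  open import Algebra.Properties.Monoid.Mult +-monoid using (×-homo-+) renaming (_×_ to _·_)
  open Sequences commutativeRing
  open Products commutativeRing
  open Relation.Binary.Reasoning.Setoid setoid

  fromℤ-⊖ : ∀ m n → fromℤ (m ℤ.⊖ n) ≈ m · 1# ⊖ n · 1#
  fromℤ-⊖ m       zero    = sym (trans (+-congˡ -0#≈0#) (+-identityʳ _))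
  fromℤ-⊖ zero    (suc n) = sym (+-identityˡ _)
  fromℤ-⊖ (suc m) (suc n) = begin
    fromℤ (suc m ℤ.⊖ suc n)            ≡⟨ cong fromℤ (ℤ.[1+m]⊖[1+n]≡m⊖n m n) ⟩
    fromℤ (m ℤ.⊖ n)                    ≈⟨ fromℤ-⊖ m n ⟩
    m · 1# ⊖ n · 1#                    ≈⟨ +-congʳ (+-identityˡ _) ⟨
    (0# ⊕ m · 1#) ⊖ n · 1#             ≈⟨ +-congʳ (+-congʳ (-‿inverseʳ 1#)) ⟨
    ((1# ⊖ 1#) ⊕ m · 1#) ⊖ n · 1#      ≈⟨ +-congʳ (trans (+-assoc _ _ _) (trans (+-congˡ (+-comm _ _)) (sym (+-assoc _ _ _)))) ⟩
    ((1# ⊕ m · 1#) ⊖ 1#) ⊖ n · 1#      ≈⟨ +-assoc _ _ _ ⟩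
    (1# ⊕ m · 1#) ⊕ (⊝ 1# ⊖ n · 1#)    ≈⟨ +-congˡ (-‿+-comm 1# (n · 1#)) ⟩
    (1# ⊕ m · 1#) ⊖ (1# ⊕ n · 1#)      ∎

  fromℤ-+ : ∀ i j → fromℤ (i ℤ.+ j) ≈ fromℤ i ⊕ fromℤ j
  fromℤ-+ (+ m)    (+ n)    = ×-homo-+ 1# m n
  fromℤ-+ (+ m)    -[1+ n ] = fromℤ-⊖ m (suc n)
  fromℤ-+ -[1+ m ] (+ n)    = trans (fromℤ-⊖ n (suc m)) (+-comm _ _)
  fromℤ-+ -[1+ m ] -[1+ n ] = begin
    ⊝ (suc (suc (m ℕ.+ n)) · 1#)       ≡⟨ cong (λ k → ⊝ (suc k · 1#)) (ℕ.+-suc m n) ⟨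
    ⊝ ((suc m ℕ.+ suc n) · 1#)         ≈⟨ -‿cong (×-homo-+ 1# (suc m) (suc n)) ⟩
    ⊝ (suc m · 1# ⊕ suc n · 1#)        ≈⟨ -‿+-comm _ _ ⟨
    ⊝ (suc m · 1#) ⊖ suc n · 1#        ∎

  fromℤ-neg : ∀ i → fromℤ (ℤ.- i) ≈ ⊝ fromℤ i
  fromℤ-neg (+ zero)  = sym -0#≈0#
  fromℤ-neg (+ suc n) = refl
  fromℤ-neg -[1+ n ]  = sym (-‿involutive _)

  fromℤ-δ : fromℤ ∘ ℤSeq.δ ≋ δ
  fromℤ-δ (+ zero)  = +-identityʳ 1#
  fromℤ-δ (+ suc _) = refl
  fromℤ-δ -[1+ _ ]  = refl

  fromℤ-Ts : ∀ ms f → fromℤ ∘ ℤProd.Ts ms f ≋ Ts ms (fromℤ ∘ f)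
  fromℤ-Ts []       f = ≋-refl
  fromℤ-Ts (m ∷ ms) f = ≋-trans fromℤ-T (T-cong m (fromℤ-Ts ms f))
    where
    g = ℤProd.Ts ms f
    fromℤ-T : fromℤ ∘ ℤSeq.T m g ≋ T m (fromℤ ∘ g)
    fromℤ-T n = begin
      fromℤ (g (n ℤ.- + m) ℤ.+ -1ℤ ℤ.* g n)        ≈⟨ fromℤ-+ (g (n ℤ.- + m)) _ ⟩
      fromℤ (g (n ℤ.- + m)) ⊕ fromℤ (-1ℤ ℤ.* g n)  ≡⟨ cong (λ i → fromℤ (g (n ℤ.- + m)) ⊕ fromℤ i) (ℤ.-1*i≡-i (g n)) ⟩
      fromℤ (g (n ℤ.- + m)) ⊕ fromℤ (ℤ.- g n)      ≈⟨ +-congˡ (trans (fromℤ-neg (g n)) (sym (-1*x≈-x _))) ⟩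
      fromℤ (g (n ℤ.- + m)) ⊕ ⊝ 1# ⊗ fromℤ (g n)   ∎

  -- ¬ y ≈ 1# does not make y - 1 invertible, so x is inverted instead, under the assumption x # 0#.
  fixed⇒zero : ∀ {y x} → ¬ y ≈ 1# → y ⊗ x ≈ x → x ≈ 0#
  fixed⇒zero {y} {x} y≉1 yx≈x = proj₁ (HeytingField.tight K x 0#) λ x#0 →
    let x⁻¹ , _ , inverse = HeytingField.#⇒invertible K x#0
        xx⁻¹≈1 : x ⊗ x⁻¹ ≈ 1#
        xx⁻¹≈1 = trans (*-congʳ (sym (trans (+-congˡ -0#≈0#) (+-identityʳ x)))) inverse
    in y≉1 (begin
      y               ≈⟨ *-identityʳ y ⟨
      y ⊗ 1#          ≈⟨ *-congˡ xx⁻¹≈1 ⟨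
      y ⊗ (x ⊗ x⁻¹)   ≈⟨ *-assoc y x x⁻¹ ⟨
      y ⊗ x ⊗ x⁻¹     ≈⟨ *-congʳ yx≈x ⟩
      x ⊗ x⁻¹         ≈⟨ xx⁻¹≈1 ⟩
      1#              ∎)

  -- The multiples of d below N are dj with j < m, so the roots are the powers of ζᵈ, a primitive
  -- m-th root of unity, and `Π<-powers` applies. Its cancellation condition holds because 0 < n < m
  -- gives 0 < dn < N.
  Π-multiples : ∀ {N ζ} d m → N ≡ d * m → 0 < N → IsPrimitiveRoot N ζ → Π (ζ ^_) (filter (d ∣?_) (upTo N)) δ ≋ T m δ
  Π-multiples d zero ≡.refl 0<N _ = contradiction (ℕ.*-zeroʳ d) (ℕ.<⇒≢ 0<N ∘ ≡.sym)
  Π-multiples {ζ = ζ} d@(suc _) (suc m) ≡.refl _ (ζ^N≈1 , ζ^k≉1) = ≋-trans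
    (Π-↭ (ζ ^_) δ (multiples d (suc m))) (≋-trans
    (≡⇒≋ (Π-map-upTo (ζ ^_) (d *_) (suc m) δ)) (≋-trans
    (Π<-cong (suc m) δ (λ k → sym (^-assocʳ ζ d k)))
    (Π<-powers (ζ ^ d) m (trans (^-assocʳ ζ d (suc m)) ζ^N≈1) λ n x 0<n n<m fixed →
      fixed⇒zero (λ e → ζ^k≉1 (d * n) (ℕ.*-mono-< {0} {d} {0} (s≤s z≤n) 0<n) (ℕ.*-monoʳ-< d n<m)
        (trans (sym (^-assocʳ ζ d n)) e)) fixed)))

  module Ternary (p q r : ℕ) (pp : Prime p) (pq : Prime q) (pr : Prime r)
    (p≢q : p ≢ q) (p≢r : p ≢ r) (q≢r : q ≢ r)
    (ζ : Carrier) (ζ-primitive : IsPrimitiveRoot (p * q * r) ζ) where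

    N = p * q * r

    private instance
      p≢0 : NonZero p
      p≢0 = prime⇒nonZero pp
      q≢0 : NonZero q
      q≢0 = prime⇒nonZero pq
      r≢0 : NonZero r
      r≢0 = prime⇒nonZero pr

    p⊥q : Coprime p q
    p⊥q = prime∤⇒coprime pq (prime∤prime pp pq p≢q)
    p⊥r : Coprime p r
    p⊥r = prime∤⇒coprime pr (prime∤prime pp pr p≢r)
    q⊥r : Coprime q r
    q⊥r = prime∤⇒coprime pr (prime∤prime pq pr q≢r)

    open Jumps p q r (ℕ.nonTrivial⇒n>1 q {{prime⇒nonTrivial pq}})
      (ℕ.nonTrivial⇒n>1 r {{prime⇒nonTrivial pr}}) p⊥q p⊥r q⊥r
    open Coordinates p q r p⊥q p⊥r q⊥r using (M; M-causal; T-pq-pr-qr-M)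

    0<* : ∀ {m n} → 0 < m → 0 < n → 0 < m * n
    0<* = ℕ.*-mono-< {0} {_} {0}

    0<p : 0 < p
    0<p = ℕ.>-nonZero⁻¹ p
    0<q : 0 < q
    0<q = ℕ.>-nonZero⁻¹ q
    0<r : 0 < r
    0<r = ℕ.>-nonZero⁻¹ r

    0<N : 0 < N
    0<N = 0<* (0<* 0<p 0<q) 0<r

    ρ : ℕ → Carrier
    ρ = ζ ^_

    D : ℕ → List ℕ
    D d = filter (d ∣?_) (upTo N)

    Π-D-Ts : ∀ d m ms {f} → N ≡ d * m → f ≋ Ts ms δ → Π ρ (D d) f ≋ Ts (m ∷ ms) δ
    Π-D-Ts d m ms eq e = ≋-trans (Π-cong ρ (D d) e) (Π-Ts-δ ρ (D d) m ms (Π-multiples d m eq 0<N ζ-primitive))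

    Π-filter-Πʷ : ∀ {ℓ} {A : ℕ → Set ℓ} (A? : Decidable A) v {f} → f ≋ Πʷ ρ v (upTo N) δ →
            Π ρ (filter A? (upTo N)) f ≋ Πʷ ρ (λ k → indicator (A? k) ℕ.+ v k) (upTo N) δ
    Π-filter-Πʷ A? v {f} e = ≋-trans (≡⇒≋ (Π-filter ρ A? (upTo N) f))
      (≋-trans (Πʷ-cong ρ (indicator ∘ A?) (upTo N) e) (≋-sym (Πʷ-+ ρ (indicator ∘ A?) v (upTo N) δ)))

    -- The product identity for Φ. The binomials on the left are replaced by products over multiples
    -- of p, q, r and N, all factors are collected into multiplicities on `upTo N`,
    -- inclusion-exclusion rewrites these, and the result is read back as binomials.
    coefficients : Ts (q * r ∷ p * r ∷ p * q ∷ 1 ∷ []) (coeff (Φ N ζ)) ≋ Ts (N ∷ r ∷ q ∷ p ∷ []) δ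
    coefficients = ≋-trans
      (Ts-cong (q * r ∷ p * r ∷ p * q ∷ 1 ∷ []) (coeff-∏ₚ ρ (totatives N))) (≋-trans
      (≋-sym (Π-Ts ρ (totatives N) (q * r ∷ p * r ∷ p * q ∷ 1 ∷ []) δ)) (≋-trans
      (Π-cong ρ (totatives N) (≋-sym left)) (≋-trans
      (Π-filter-Πʷ (totative? N) _ (Π-filter-Πʷ (p ∣?_) _ (Π-filter-Πʷ (q ∣?_) _ (Π-filter-Πʷ (r ∣?_) _
        (≡⇒≋ (Π-filter ρ (N ∣?_) (upTo N) δ)))))) (≋-trans
      (≡⇒≋ (Πʷ-≡ ρ (upTo N) δ (inclusion–exclusion pp pq pr p⊥q p⊥r q⊥r))) (≋-trans
      (≋-sym (Π-filter-Πʷ (1 ∣?_) _ (Π-filter-Πʷ (p * q ∣?_) _ (Π-filter-Πʷ (p * r ∣?_) _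
        (≡⇒≋ (Π-filter ρ (q * r ∣?_) (upTo N) δ)))))) right)))))
      where
      left : Π ρ (D p) (Π ρ (D q) (Π ρ (D r) (Π ρ (D N) δ))) ≋ Ts (q * r ∷ p * r ∷ p * q ∷ 1 ∷ []) δ
      left = Π-D-Ts p (q * r) (p * r ∷ p * q ∷ 1 ∷ []) (ℕ.*-assoc p q r)
        (Π-D-Ts q (p * r) (p * q ∷ 1 ∷ []) (≡.trans (cong (_* r) (ℕ.*-comm p q)) (ℕ.*-assoc q p r))
        (Π-D-Ts r (p * q) (1 ∷ []) (ℕ.*-comm (p * q) r)
        (Π-D-Ts N 1 [] (≡.sym (ℕ.*-identityʳ N)) ≋-refl)))
      right : Π ρ (D 1) (Π ρ (D (p * q)) (Π ρ (D (p * r)) (Π ρ (D (q * r)) δ))) ≋ Ts (N ∷ r ∷ q ∷ p ∷ []) δ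
      right = Π-D-Ts 1 N (r ∷ q ∷ p ∷ []) (≡.sym (ℕ.*-identityˡ N))
        (Π-D-Ts (p * q) r (q ∷ p ∷ []) ≡.refl
        (Π-D-Ts (p * r) q (p ∷ []) (≡.trans (ℕ.*-assoc p q r) (≡.trans (cong (p *_) (ℕ.*-comm q r)) (≡.sym (ℕ.*-assoc p r q))))
        (Π-D-Ts (q * r) p [] (≡.trans (ℕ.*-assoc p q r) (ℕ.*-comm p (q * r))) ≋-refl)))

    b : ℤ → ℤ
    b = ℤSeq.T p (ℤSeq.T q (ℤSeq.T r M))

    b-causal : ℤSeq.Causal b
    b-causal = ℤProd.Ts-causal (p ∷ q ∷ r ∷ []) M M-causal

    a : ℤ → ℤ
    a = partialSums b

    -- The factor x - 1 turns `a` into `b`. Reordering then brings the binomials for pq, pr and qr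
    -- directly onto `M`, where `T-pq-pr-qr-M` replaces them by `T N δ`.
    a-identity : ∀ n → ℤProd.Ts (q * r ∷ p * r ∷ p * q ∷ 1 ∷ []) a n ≡ ℤProd.Ts (N ∷ r ∷ q ∷ p ∷ []) ℤSeq.δ n
    a-identity = ℤProd.≋-trans
      (ℤProd.Ts-cong (q * r ∷ p * r ∷ p * q ∷ []) (T-partialSums b-causal)) (ℤProd.≋-trans
      (ℤProd.Ts-↭ M (↭-trans (++-comm (q * r ∷ p * r ∷ p * q ∷ []) (p ∷ q ∷ r ∷ []))
        (++⁺ˡ (p ∷ q ∷ r ∷ []) (↭-sym (↭-reverse (q * r ∷ p * r ∷ p * q ∷ [])))))) (ℤProd.≋-trans
      (ℤProd.Ts-cong (p ∷ q ∷ r ∷ []) T-pq-pr-qr-M)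
      (ℤProd.Ts-↭ ℤSeq.δ (↭-sym (↭-reverse (p ∷ q ∷ r ∷ N ∷ []))))))

    coeff-causal : Causal (coeff (Φ N ζ))
    coeff-causal _ = refl

    -- Both causal sequences become equal after multiplication by the same binomials, which
    -- `Ts-injective` cancels; `fromℤ` commutes with `Ts`, which carries the integer identity over
    -- to the field.
    coeff≈a : ∀ n → coeff (Φ N ζ) n ≈ fromℤ (a n)
    coeff≈a = Ts-injective {q * r ∷ p * r ∷ p * q ∷ 1 ∷ []} {coeff (Φ N ζ)} {fromℤ ∘ a}
      (0<* 0<q 0<r ∷ 0<* 0<p 0<r ∷ 0<* 0<p 0<q ∷ s≤s z≤n ∷ []) coeff-causal (λ _ → refl)
      (≋-trans coefficients (≋-sym (≋-trans
        (≋-sym (fromℤ-Ts (q * r ∷ p * r ∷ p * q ∷ 1 ∷ []) a)) (≋-trans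
        (λ n → reflexive (cong fromℤ (a-identity n))) (≋-trans
        (fromℤ-Ts (N ∷ r ∷ q ∷ p ∷ []) ℤSeq.δ)
        (Ts-cong (N ∷ r ∷ q ∷ p ∷ []) fromℤ-δ))))))

    a-jump : ∀ n → ∣ a n ℤ.- a (n ℤ.- 1ℤ) ∣ ≤ 1
    a-jump n = ≡.subst (_≤ 1) (≡.trans (≡.sym (ℤ.∣-i∣≡∣i∣ (b n))) (cong ∣_∣ difference)) (jump-bound n)
      where
      negate : ∀ x y → ℤ.- (y ℤ.+ -1ℤ ℤ.* x) ≡ x ℤ.- y
      negate = solve-∀
      difference : ℤ.- b n ≡ a n ℤ.- a (n ℤ.- 1ℤ)
      -- `T 1 a n` is a (n - 1) - a n, so `b n` is the jump with the opposite sign.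
      difference = ≡.trans (cong ℤ.-_ (≡.sym (T-partialSums b-causal n))) (negate (a n) (a (n ℤ.- 1ℤ)))

open import Data.Integer.Base using (_-_)

theorem3 : ∀ {c ℓ₁ ℓ₂} (K : HeytingField c ℓ₁ ℓ₂) →
    let open Cyclotomic K in
    CharacteristicZero →
    (p q r : ℕ) → Prime p → Prime q → Prime r →
    p ≢ q → p ≢ r → q ≢ r → p < q → p < r →
    (ζ : Carrier) → IsPrimitiveRoot (p * q * r) ζ →
    Σ (ℤ → ℤ) λ a →
    (∀ n → coeff (Φ (p * q * r) ζ) n ≈ fromℤ (a n)) ×
    (∀ n → ∣ a n - a (n - 1ℤ) ∣ ≤ 1)
theorem3 K _ p q r pp pq pr p≢q p≢r q≢r _ _ ζ ζ-primitive =
  a , coeff≈a , a-jump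
  where open Coefficients.Ternary K p q r pp pq pr p≢q p≢r q≢r ζ ζ-primitive
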